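{- Let $q$ be a prime power, $\pi={\rm PG}(2,q)$, $C_1$ a Singer cyclic subgroup of ${\rm PGL}(3,q)$ acting on $\pi$, and $\mathcal B$ the circumscribed bundle of $\pi$ left invariant by $C_1$. Let $\mathcal C,\mathcal C'$ be two distinct conics of $\mathcal B$ and let $g\in C_1$ with $\mathcal C'=\mathcal C^g$. If $\mathcal C\cap\mathcal C'=\{B\}$ and $A\in\mathcal C$ with $A^g=B$, then $B$ lies on the line $PP^g$ for every point $P\in\mathcal C\setminus\{A,B\}$. In particular, the lines $BB^g$ and $BB^{g^{ -1}}$ are tangent to $\mathcal C$ and $\mathcal C'$ at $B$, respectively.
   Context: A Singer cyclic subgroup of ${\rm PGL}(3,q)$ is a cyclic group of order $q^2+q+1$ acting regularly on the points of ${\rm PG}(2,q)$. Embed $\pi$ in $\Pi={\rm PG}(2,q^3)$ as the set of points fixed by a collineation of order $3$ (induced by the Frobenius $x\mapsto x^q$); $C_1$ extends to $\Pi$ and fixes a triangle $\Delta$ of $\Pi$ whose three vertices lie in $\Pi\setminus\pi$. The circumscribed bundle $\mathcal B$ is the set of non-degenerate conics of $\pi$ whose extensions over ${\rm GF}(q^3)$ contain the three vertices of $\Delta$; it consists of $q^2+q+1$ conics, any two meeting in exactly one point. -}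

module Defs where

open import Data.Nat using (ℕ; zero; suc; _^_)
open import Data.Nat.Primality using (Prime)
open import Data.Fin using (Fin; zero; suc; _≟_)
open import Data.Product using (∃; _×_; _,_)
open import Data.Bool using (if_then_else_)
open import Relation.Binary.PropositionalEquality using (_≡_; _≢_)
open import Relation.Nullary using (¬_; does)
open import Function.Bundles using (_↔_)
open import Algebra.Core using (Op₁; Op₂)
open import Algebra.Structures using (IsCommutativeRing)

record Field : Set₁ where
  infixl 6 _+_ _-_
  infixl 7 _*_
  field
    Carrier : Set
    _+_ _*_ : Op₂ Carrier
    -_ : Op₁ Carrier
    0# 1# : Carrier
    isCommutativeRing : IsCommutativeRing _≡_ _+_ _*_ -_ 0# 1#
    0≢1 : 0# ≢ 1#
    inverse : ∀ x → x ≢ 0# → ∃ λ y → x * y ≡ 1#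
  _-_ : Op₂ Carrier
  x - y = x + (- y)

HasOrder : Field → ℕ → Set
HasOrder F n = Field.Carrier F ↔ Fin n

IsPrimePower : ℕ → Set
IsPrimePower q = ∃ λ p → ∃ λ k → Prime p × q ≡ p ^ suc k

record FieldEmbedding (F K : Field) : Set where
  private
    module F = Field F
    module K = Field K
  field
    map : F.Carrier → K.Carrier
    map-+ : ∀ x y → map (x F.+ y) ≡ map x K.+ map y
    map-* : ∀ x y → map (x F.* y) ≡ map x K.* map y
    map-1 : map F.1# ≡ K.1#

record Vec3 (F : Field) : Set where
  constructor vec
  field coord : Fin 3 → Field.Carrier F
open Vec3 public

record Mat3 (F : Field) : Set where
  constructor mat
  field entry : Fin 3 → Fin 3 → Field.Carrier F
open Mat3 public

-- ternary quadratic form  a x0² + b x1² + c x2² + d x0x1 + e x0x2 + f x1x2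
record QForm (F : Field) : Set where
  constructor qform
  field a b c d e f : Field.Carrier F

i0 i1 i2 : Fin 3
i0 = zero
i1 = suc zero
i2 = suc (suc zero)

module _ {F : Field} where
  open Field F

  Σ3 : (Fin 3 → Carrier) → Carrier
  Σ3 h = h i0 + h i1 + h i2

  -- a nonzero vector represents a point of PG(2,F)
  NonZero : Vec3 F → Set
  NonZero v = ¬ (∀ i → coord v i ≡ 0#)

  _∼_ : Vec3 F → Vec3 F → Set
  u ∼ v = ∃ λ λ₀ → λ₀ ≢ 0# × (∀ i → coord u i ≡ λ₀ * coord v i)

  _·_ : Mat3 F → Vec3 F → Vec3 F
  M · v = vec (λ i → Σ3 (λ j → entry M i j * coord v j))

  _⊗_ : Mat3 F → Mat3 F → Mat3 F
  M ⊗ N = mat (λ i k → Σ3 (λ j → entry M i j * entry N j k))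

  I3 : Mat3 F
  I3 = mat (λ i j → if does (i ≟ j) then 1# else 0#)

  _^ᴹ_ : Mat3 F → ℕ → Mat3 F
  M ^ᴹ zero = I3
  M ^ᴹ suc k = M ⊗ (M ^ᴹ k)

  Invertible : Mat3 F → Set
  Invertible M = ∃ λ N → ∀ i j → entry (M ⊗ N) i j ≡ entry I3 i j

  _≃ᴹ_ : Mat3 F → Mat3 F → Set
  M ≃ᴹ N = ∃ λ λ₀ → λ₀ ≢ 0# × (∀ i j → entry M i j ≡ λ₀ * entry N i j)

  record IsSingerGenerator (n : ℕ) (σ : Mat3 F) : Set where
    field
      invertible : Invertible σ
      order      : (σ ^ᴹ n) ≃ᴹ I3
      order-min  : ∀ i → 0 Data.Nat.< i → i Data.Nat.< n → ¬ ((σ ^ᴹ i) ≃ᴹ I3)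
      transitive : ∀ P Q → NonZero P → NonZero Q → ∃ λ i → ((σ ^ᴹ i) · P) ∼ Q
      free       : ∀ i P → NonZero P → ((σ ^ᴹ i) · P) ∼ P → (σ ^ᴹ i) ≃ᴹ I3

  eval : QForm F → Vec3 F → Carrier
  eval (qform a b c d e f) v =
    a * x * x + b * y * y + c * z * z + d * x * y + e * x * z + f * y * z
    where
      x = coord v i0
      y = coord v i1
      z = coord v i2

  -- Hirschfeld's discriminant 4abc − af² − be² − cd² + def (valid in every characteristic)
  disc : QForm F → Carrier
  disc (qform a b c d e f) =
    (1# + 1# + 1# + 1#) * a * b * c - a * f * f - b * e * e - c * d * d + d * e * f

  NonDegenerate : QForm F → Set
  NonDegenerate Q = disc Q ≢ 0#

  OnConic : QForm F → Vec3 F → Set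
  OnConic Q v = eval Q v ≡ 0#

  SameConic : QForm F → QForm F → Set
  SameConic Q Q' = ∀ P → NonZero P → (OnConic Q P → OnConic Q' P) × (OnConic Q' P → OnConic Q P)

  IsImageConic : QForm F → Mat3 F → QForm F → Set
  IsImageConic Q' g Q = ∀ P → NonZero P → (OnConic Q P → OnConic Q' (g · P)) × (OnConic Q' (g · P) → OnConic Q P)

  det3 : Vec3 F → Vec3 F → Vec3 F → Carrier
  det3 u v w =
      coord u i0 * (coord v i1 * coord w i2 - coord v i2 * coord w i1)
    - coord u i1 * (coord v i0 * coord w i2 - coord v i2 * coord w i0)
    + coord u i2 * (coord v i0 * coord w i1 - coord v i1 * coord w i0)

  OnLineThrough : Vec3 F → Vec3 F → Vec3 F → Set
  OnLineThrough X P R = det3 X P R ≡ 0#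

  TangentAt : QForm F → Vec3 F → Vec3 F → Set
  TangentAt Q B R =
    OnConic Q B × ¬ (R ∼ B) ×
    (∀ X → NonZero X → OnLineThrough X B R → OnConic Q X → X ∼ B)

module _ {F K : Field} (ι : FieldEmbedding F K) where
  open FieldEmbedding ι

  liftMat : Mat3 F → Mat3 K
  liftMat M = mat (λ i j → map (entry M i j))

  liftQ : QForm F → QForm K
  liftQ (qform a b c d e f) = qform (map a) (map b) (map c) (map d) (map e) (map f)

  -- the vertices of the triangle Δ are the points of Π fixed by (the
  -- extension of) C₁ = ⟨σ⟩; Q is in the circumscribed bundle iff it is a
  -- non-degenerate conic of π whose extension contains these points.
  InCircumscribedBundle : Mat3 F → QForm F → Set
  InCircumscribedBundle σ Q =
    NonDegenerate Q ×
    (∀ v → NonZero v → (liftMat σ · v) ∼ v → OnConic (liftQ Q) v)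

module Submission where

-- Over K = GF(q³) the Singer generator σ diagonalises. A geometric sum over K×
-- gives an eigenvector w₁ whose Frobenius conjugates w₂, w₃ are eigenvectors for
-- the conjugate eigenvalues λ₁, λ₂, λ₃; these are distinct, since an eigenvalue
-- in GF(q) would give a point of π fixed by σ. The vertices of Δ are w₁, w₂, w₃,
-- so in eigencoordinates every conic of the bundle reads a yz + b xz + c xy with
-- abc ≠ 0, and g = σᵏ acts as Λ = diag(λ₁ᵏ, λ₂ᵏ, λ₃ᵏ) with distinct entries.
-- If P0 and Λ P0 both lie on such a conic, P0 is one explicit point, and two
-- polynomial identities then show that Λ P0 lies on every line P (Λ P) with P on
-- the conic, and that the line through Λ P0 and Λ² P0 meets the conic only in
-- Λ P0. Taking P0 = A, so that Λ P0 = B, gives the first two claims; the third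
-- is the second for σ^(N−k), which maps 𝒞′ back onto 𝒞.

open import Defs
open import Algebra.Bundles using (CommutativeRing)
import Algebra.Properties.CommutativeMonoid.Sum as CommutativeMonoidSum
import Algebra.Properties.CommutativeSemiring.Binomial as Binomial
import Algebra.Properties.Semiring.Sum as SemiringSum
import Algebra.Solver.Ring as RingSolver
open import Algebra.Solver.Ring.AlmostCommutativeRing
  using (AlmostCommutativeRing; fromCommutativeRing; _-Raw-AlmostCommutative⟶_)
open import Data.Empty using (⊥; ⊥-elim)
open import Data.Fin as Fin using (Fin; toℕ; inject₁; fromℕ; punchIn)
import Data.Fin.Properties as Fin
open import Data.Fin.Permutation using (Permutation; permutation)
open import Data.Integer as ℤ using (ℤ; -[1+_]; _⊖_; _◃_; sign; ∣_∣; 0ℤ; 1ℤ)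
import Data.Integer.Properties as ℤ
open import Data.List using (List; []; _∷_; _++_; length; tabulate; replicate)
import Data.List.Properties as List
open import Data.List.Relation.Unary.All using (All; []; _∷_)
import Data.List.Relation.Unary.All.Properties as All
open import Data.List.Relation.Unary.AllPairs using (AllPairs; []; _∷_)
import Data.List.Relation.Unary.Unique.Propositional.Properties as Unique
open import Data.Maybe using (Maybe; just; nothing)
open import Data.Nat as ℕ using (ℕ; zero; suc; _≤_; _<_; z≤n; s≤s; _!; _∸_)
open import Data.Nat.Combinatorics using (_C_; nCn≡1; nCk≡nC[n∸k]; k![n∸k]!∣n!)
open import Data.Nat.Combinatorics.Specification using (nCk≡n!/k![n-k]!)
open import Data.Nat.Divisibility using (_∣_; divides; ∣1⇒≡1; ∣⇒≤; m∣m*n)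
open import Data.Nat.DivMod using (m/n*n≡m)
open import Data.Nat.Solver using (module +-*-Solver)
open import Data.Nat.Primality using (Prime; euclidsLemma; ¬prime[0]; ¬prime[1])
import Data.Nat.Properties as ℕ
open import Data.Product using (∃; _×_; _,_; proj₁; proj₂)
open import Data.Sign as Sign using (Sign)
open import Data.Sum using (_⊎_; inj₁; inj₂)
import Data.Vec.Functional as Vector
open import Function.Bundles using (_↔_; Inverse)
open import Relation.Binary.PropositionalEquality
open import Relation.Nullary using (¬_; Dec; yes; no; ¬?)
open import Relation.Nullary.Decidable using (decidable-stable)

module FieldProperties (F : Field) where
  open Field F
  open ≡-Reasoning

  commutativeRing : CommutativeRing _ _
  commutativeRing = record { isCommutativeRing = isCommutativeRing }

  open CommutativeRing commutativeRing public
    using ( +-comm; +-assoc; +-identityˡ; +-identityʳ; -‿inverseˡ; -‿inverseʳ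
          ; *-comm; *-assoc; *-identityˡ; *-identityʳ; zeroˡ; zeroʳ
          ; ring; semiring; commutativeSemiring; +-group; +-commutativeMonoid; *-commutativeMonoid )
  open import Algebra.Properties.Ring ring public
    using (-‿involutive; -‿distribˡ-*; -0#≈0#)
  open import Algebra.Properties.Group +-group public
    using (∙-cancelˡ; ∙-cancelʳ; inverseʳ-unique)
    renaming (⁻¹-anti-homo-∙ to -‿anti-homo-+)
  open import Algebra.Properties.Semiring.Mult semiring public
    using (×1-homo-*; ×-assoc-*; ×-assocˡ) renaming (_×_ to _×ᵣ_)
  open import Algebra.Properties.Semiring.Exp semiring public
    using (_^_; ^-assocʳ)
  open import Algebra.Properties.CommutativeSemiring.Exp commutativeSemiring public
    using (^-distrib-*)

  private
    open import Algebra.Properties.Semiring.Mult.TCOptimised semiring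
      using (1+×) renaming (_×_ to _×′_; ×-homo-+ to ×′-homo-+; ×1-homo-* to ×′1-homo-*)
    open import Algebra.Properties.CommutativeSemigroup (CommutativeRing.+-commutativeSemigroup commutativeRing)
      using () renaming (interchange to +-interchange)
    open import Algebra.Properties.CommutativeSemigroup (CommutativeRing.*-commutativeSemigroup commutativeRing)
      using () renaming (interchange to *-interchange)

    -- The optimised multiple makes the literal 1 denote 1# itself, so that the
    -- solver's constants are the field's own 0# and 1#.
    ⟦_⟧ : ℤ → Carrier
    ⟦ ℤ.+ n ⟧ = n ×′ 1#
    ⟦ -[1+ n ] ⟧ = - (suc n ×′ 1#)

    ⟦sign⟧ : Sign → Carrier
    ⟦sign⟧ Sign.+ = 1#
    ⟦sign⟧ Sign.- = - 1#

    ⊖-homo : ∀ m n → ⟦ m ⊖ n ⟧ ≡ m ×′ 1# - n ×′ 1#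
    ⊖-homo m zero = begin
      m ×′ 1#          ≡⟨ +-identityʳ _ ⟨
      m ×′ 1# + 0#     ≡⟨ cong ((m ×′ 1#) +_) -0#≈0# ⟨
      m ×′ 1# - 0#     ∎
    ⊖-homo zero (suc n) = sym (+-identityˡ _)
    ⊖-homo (suc m) (suc n) = begin
      ⟦ suc m ⊖ suc n ⟧                        ≡⟨ cong ⟦_⟧ (ℤ.[1+m]⊖[1+n]≡m⊖n m n) ⟩
      ⟦ m ⊖ n ⟧                                ≡⟨ ⊖-homo m n ⟩
      m ×′ 1# - n ×′ 1#                        ≡⟨ +-identityˡ _ ⟨
      0# + (m ×′ 1# - n ×′ 1#)                 ≡⟨ cong (_+ (m ×′ 1# - n ×′ 1#)) (-‿inverseʳ 1#) ⟨
      (1# - 1#) + (m ×′ 1# + - (n ×′ 1#))      ≡⟨ +-interchange 1# (- 1#) (m ×′ 1#) (- (n ×′ 1#)) ⟩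
      (1# + m ×′ 1#) + (- 1# + - (n ×′ 1#))    ≡⟨ cong ((1# + m ×′ 1#) +_) (-‿anti-homo-+ (n ×′ 1#) 1#) ⟨
      (1# + m ×′ 1#) - (n ×′ 1# + 1#)          ≡⟨ cong₂ _-_ (sym (1+× m 1#)) (trans (+-comm _ 1#) (sym (1+× n 1#))) ⟩
      suc m ×′ 1# - suc n ×′ 1#                ∎

    ◃-homo : ∀ s n → ⟦ s ◃ n ⟧ ≡ ⟦sign⟧ s * n ×′ 1#
    ◃-homo s zero = sym (zeroʳ _)
    ◃-homo Sign.+ (suc n) = sym (*-identityˡ _)
    ◃-homo Sign.- (suc n) = trans (cong -_ (sym (*-identityˡ _))) (-‿distribˡ-* 1# _)

    sign-homo : ∀ s t → ⟦sign⟧ (s Sign.* t) ≡ ⟦sign⟧ s * ⟦sign⟧ t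
    sign-homo Sign.+ _ = sym (*-identityˡ _)
    sign-homo Sign.- Sign.+ = sym (*-identityʳ _)
    sign-homo Sign.- Sign.- = sym (begin
      - 1# * - 1#   ≡⟨ -‿distribˡ-* 1# (- 1#) ⟨
      - (1# * - 1#) ≡⟨ cong -_ (*-identityˡ _) ⟩
      - - 1#        ≡⟨ -‿involutive 1# ⟩
      1#            ∎)

    sign-split : ∀ i → ⟦ i ⟧ ≡ ⟦sign⟧ (sign i) * ∣ i ∣ ×′ 1#
    sign-split i = trans (cong ⟦_⟧ (sym (ℤ.◃-inverse i))) (◃-homo (sign i) ∣ i ∣)

    +-homo : ∀ i j → ⟦ i ℤ.+ j ⟧ ≡ ⟦ i ⟧ + ⟦ j ⟧
    +-homo (ℤ.+ m) (ℤ.+ n) = ×′-homo-+ 1# m n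
    +-homo (ℤ.+ m) -[1+ n ] = ⊖-homo m (suc n)
    +-homo -[1+ m ] (ℤ.+ n) = trans (⊖-homo n (suc m)) (+-comm _ _)
    +-homo -[1+ m ] -[1+ n ] = begin
      - (suc (suc (m ℕ.+ n)) ×′ 1#)            ≡⟨ cong (λ t → - (suc t ×′ 1#)) (ℕ.+-suc m n) ⟨
      - ((suc m ℕ.+ suc n) ×′ 1#)              ≡⟨ cong -_ (×′-homo-+ 1# (suc m) (suc n)) ⟩
      - (suc m ×′ 1# + suc n ×′ 1#)            ≡⟨ -‿anti-homo-+ _ _ ⟩
      - (suc n ×′ 1#) + - (suc m ×′ 1#)        ≡⟨ +-comm _ _ ⟩
      - (suc m ×′ 1#) + - (suc n ×′ 1#)        ∎

    *-homo : ∀ i j → ⟦ i ℤ.* j ⟧ ≡ ⟦ i ⟧ * ⟦ j ⟧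
    *-homo i j = begin
      ⟦ (sign i Sign.* sign j) ◃ (∣ i ∣ ℕ.* ∣ j ∣) ⟧
        ≡⟨ ◃-homo (sign i Sign.* sign j) (∣ i ∣ ℕ.* ∣ j ∣) ⟩
      ⟦sign⟧ (sign i Sign.* sign j) * (∣ i ∣ ℕ.* ∣ j ∣) ×′ 1#
        ≡⟨ cong₂ _*_ (sign-homo (sign i) (sign j)) (×′1-homo-* ∣ i ∣ ∣ j ∣) ⟩
      (⟦sign⟧ (sign i) * ⟦sign⟧ (sign j)) * (∣ i ∣ ×′ 1# * ∣ j ∣ ×′ 1#)
        ≡⟨ *-interchange _ _ _ _ ⟩
      (⟦sign⟧ (sign i) * ∣ i ∣ ×′ 1#) * (⟦sign⟧ (sign j) * ∣ j ∣ ×′ 1#)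
        ≡⟨ cong₂ _*_ (sign-split i) (sign-split j) ⟨
      ⟦ i ⟧ * ⟦ j ⟧ ∎

    -‿homo : ∀ i → ⟦ ℤ.- i ⟧ ≡ - ⟦ i ⟧
    -‿homo (ℤ.+ zero) = sym -0#≈0#
    -‿homo (ℤ.+ suc n) = refl
    -‿homo -[1+ n ] = sym (-‿involutive _)

    almostCommutativeRing : AlmostCommutativeRing _ _
    almostCommutativeRing = fromCommutativeRing commutativeRing

    ℤ-homomorphism : ℤ.+-*-rawRing -Raw-AlmostCommutative⟶ almostCommutativeRing
    ℤ-homomorphism = record
      { ⟦_⟧ = ⟦_⟧ ; +-homo = +-homo ; *-homo = *-homo ; -‿homo = -‿homo ; 0-homo = refl ; 1-homo = refl }

    ℤ-equal? : ∀ i j → Maybe (⟦ i ⟧ ≡ ⟦ j ⟧)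
    ℤ-equal? i j with i ℤ.≟ j
    ... | yes i≡j = just (cong ⟦_⟧ i≡j)
    ... | no _ = nothing

  module Solver = RingSolver ℤ.+-*-rawRing almostCommutativeRing ℤ-homomorphism ℤ-equal?

  1≢0 : 1# ≢ 0#
  1≢0 1≡0 = 0≢1 (sym 1≡0)

  infix 9 _⁻¹⟨_⟩
  _⁻¹⟨_⟩ : (x : Carrier) → x ≢ 0# → Carrier
  x ⁻¹⟨ x≢0 ⟩ = proj₁ (inverse x x≢0)

  inverseʳ : ∀ x (x≢0 : x ≢ 0#) → x * x ⁻¹⟨ x≢0 ⟩ ≡ 1#
  inverseʳ x x≢0 = proj₂ (inverse x x≢0)

  inverseˡ : ∀ x (x≢0 : x ≢ 0#) → x ⁻¹⟨ x≢0 ⟩ * x ≡ 1#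
  inverseˡ x x≢0 = trans (*-comm _ _) (inverseʳ x x≢0)

  *-cancelˡ : ∀ {x y z} → x ≢ 0# → x * y ≡ x * z → y ≡ z
  *-cancelˡ {x} {y} {z} x≢0 xy≡xz = begin
    y                         ≡⟨ *-identityˡ y ⟨
    1# * y                    ≡⟨ cong (_* y) (inverseˡ x x≢0) ⟨
    (x ⁻¹⟨ x≢0 ⟩ * x) * y     ≡⟨ *-assoc _ _ _ ⟩
    x ⁻¹⟨ x≢0 ⟩ * (x * y)     ≡⟨ cong (x ⁻¹⟨ x≢0 ⟩ *_) xy≡xz ⟩
    x ⁻¹⟨ x≢0 ⟩ * (x * z)     ≡⟨ *-assoc _ _ _ ⟨
    (x ⁻¹⟨ x≢0 ⟩ * x) * z     ≡⟨ cong (_* z) (inverseˡ x x≢0) ⟩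
    1# * z                    ≡⟨ *-identityˡ z ⟩
    z                         ∎

  *-cancelʳ : ∀ {x y z} → x ≢ 0# → y * x ≡ z * x → y ≡ z
  *-cancelʳ x≢0 yx≡zx = *-cancelˡ x≢0 (trans (*-comm _ _) (trans yx≡zx (*-comm _ _)))

  x*y≡0⇒y≡0 : ∀ {x y} → x ≢ 0# → x * y ≡ 0# → y ≡ 0#
  x*y≡0⇒y≡0 {x} x≢0 xy≡0 = *-cancelˡ x≢0 (trans xy≡0 (sym (zeroʳ x)))

  x*y≡0⇒x≡0 : ∀ {x y} → y ≢ 0# → x * y ≡ 0# → x ≡ 0#
  x*y≡0⇒x≡0 {x} {y} y≢0 xy≡0 = x*y≡0⇒y≡0 y≢0 (trans (*-comm y x) xy≡0)

  *-nonZero : ∀ {x y} → x ≢ 0# → y ≢ 0# → x * y ≢ 0#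
  *-nonZero x≢0 y≢0 xy≡0 = y≢0 (x*y≡0⇒y≡0 x≢0 xy≡0)

  ^-nonZero : ∀ {x} n → x ≢ 0# → x ^ n ≢ 0#
  ^-nonZero zero x≢0 = 1≢0
  ^-nonZero (suc n) x≢0 = *-nonZero x≢0 (^-nonZero n x≢0)

  x-y≡0⇒x≡y : ∀ {x y} → x - y ≡ 0# → x ≡ y
  x-y≡0⇒x≡y {x} {y} x-y≡0 = begin
    x               ≡⟨ +-identityʳ x ⟨
    x + 0#          ≡⟨ cong (x +_) (-‿inverseˡ y) ⟨
    x + (- y + y)   ≡⟨ +-assoc _ _ _ ⟨
    (x - y) + y     ≡⟨ cong (_+ y) x-y≡0 ⟩
    0# + y          ≡⟨ +-identityˡ y ⟩
    y               ∎

  x≡y⇒x-y≡0 : ∀ {x y} → x ≡ y → x - y ≡ 0#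
  x≡y⇒x-y≡0 {x} refl = -‿inverseʳ x

  x≢y⇒x-y≢0 : ∀ {x y} → x ≢ y → x - y ≢ 0#
  x≢y⇒x-y≢0 x≢y x-y≡0 = x≢y (x-y≡0⇒x≡y x-y≡0)

  -‿nonZero : ∀ {x} → x ≢ 0# → - x ≢ 0#
  -‿nonZero x≢0 -x≡0 = x≢0 (trans (sym (-‿involutive _)) (trans (cong -_ -x≡0) -0#≈0#))

  +-cancelˡ : ∀ {x y z} → x + y ≡ x + z → y ≡ z
  +-cancelˡ {x} = ∙-cancelˡ x _ _

  +-cancelʳ : ∀ {x y z} → y + x ≡ z + x → y ≡ z
  +-cancelʳ {x} = ∙-cancelʳ x _ _

module FiniteField (F : Field) {m : ℕ} (enumeration : Field.Carrier F ↔ Fin (suc m)) where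
  open Field F
  open FieldProperties F
  open ≡-Reasoning

  index : Carrier → Fin (suc m)
  index = Inverse.to enumeration

  element : Fin (suc m) → Carrier
  element = Inverse.from enumeration

  index-element : ∀ i → index (element i) ≡ i
  index-element = Inverse.strictlyInverseˡ enumeration

  element-index : ∀ x → element (index x) ≡ x
  element-index = Inverse.strictlyInverseʳ enumeration

  element-injective : ∀ {i j} → element i ≡ element j → i ≡ j
  element-injective {i} {j} eq = trans (sym (index-element i)) (trans (cong index eq) (index-element j))

  infix 4 _≟_
  _≟_ : (x y : Carrier) → Dec (x ≡ y)
  x ≟ y with index x Fin.≟ index y
  ... | yes eq = yes (trans (sym (element-index x)) (trans (cong element eq) (element-index y)))
  ... | no neq = no (λ x≡y → neq (cong index x≡y))

  private
    module Product = CommutativeMonoidSum *-commutativeMonoid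
    module Sum = CommutativeMonoidSum +-commutativeMonoid

    bijection⇒permutation : (f g : Carrier → Carrier) →
      (∀ x → f (g x) ≡ x) → (∀ x → g (f x) ≡ x) → Permutation (suc m) (suc m)
    bijection⇒permutation f g fg gf = permutation (λ i → index (f (element i))) (λ i → index (g (element i)))
      (λ i → trans (cong (λ y → index (f y)) (element-index _)) (trans (cong index (fg _)) (index-element i)))
      (λ i → trans (cong (λ y → index (g y)) (element-index _)) (trans (cong index (gf _)) (index-element i)))

    nonzeroPart : Carrier → Carrier
    nonzeroPart x with x ≟ 0#
    ... | yes _ = 1#
    ... | no _ = x

    nonzeroPart-nonZero : ∀ x → nonzeroPart x ≢ 0#
    nonzeroPart-nonZero x with x ≟ 0#
    ... | yes _ = 1≢0
    ... | no x≢0 = x≢0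

    product-nonZero : ∀ {k} (f : Fin k → Carrier) → (∀ i → f i ≢ 0#) → Product.sum f ≢ 0#
    product-nonZero {zero} f _ = 1≢0
    product-nonZero {suc k} f f≢0 = *-nonZero (f≢0 Fin.zero) (product-nonZero (λ i → f (Fin.suc i)) (λ i → f≢0 (Fin.suc i)))

  -- Multiplying by x permutes the field, and it multiplies the product of the
  -- nonzero parts of all elements by x^m.
  x^m≡1 : ∀ x → x ≢ 0# → x ^ m ≡ 1#
  x^m≡1 x x≢0 = *-cancelʳ (product-nonZero _ (λ i → nonzeroPart-nonZero (element i))) (begin
    x ^ m * P                                        ≡⟨ cong (_* P) factors ⟨
    Product.sum (λ i → factor (element i)) * P        ≡⟨ Product.∑-distrib-+ (λ i → factor (element i)) (λ i → nonzeroPart (element i)) ⟨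
    Product.sum (λ i → factor (element i) * nonzeroPart (element i))
                                                     ≡⟨ Product.sum-cong-≗ {x = λ i → nonzeroPart (x * element i)} (λ i → nonzeroPart-scale (element i)) ⟨
    Product.sum (λ i → nonzeroPart (x * element i))  ≡⟨ Product.sum-cong-≗ {x = λ i → nonzeroPart (element (index (x * element i)))} (λ i → cong nonzeroPart (element-index _)) ⟨
    Product.sum (λ i → nonzeroPart (element (index (x * element i))))
                                                     ≡⟨ Product.sum-permute (λ i → nonzeroPart (element i)) scaling ⟨
    P                                                ≡⟨ *-identityˡ P ⟨
    1# * P                                           ∎)
    where
    P = Product.sum (λ i → nonzeroPart (element i))

    scaling : Permutation (suc m) (suc m)
    scaling = bijection⇒permutation (x *_) (x ⁻¹⟨ x≢0 ⟩ *_)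
      (λ y → trans (sym (*-assoc _ _ _)) (trans (cong (_* y) (inverseʳ x x≢0)) (*-identityˡ y)))
      (λ y → trans (sym (*-assoc _ _ _)) (trans (cong (_* y) (inverseˡ x x≢0)) (*-identityˡ y)))

    factor : Carrier → Carrier
    factor y with y ≟ 0#
    ... | yes _ = 1#
    ... | no _ = x

    nonzeroPart-scale : ∀ y → nonzeroPart (x * y) ≡ factor y * nonzeroPart y
    nonzeroPart-scale y with y ≟ 0# | x * y ≟ 0#
    ... | yes _ | yes _ = sym (*-identityˡ _)
    ... | yes y≡0 | no xy≢0 = ⊥-elim (xy≢0 (trans (cong (x *_) y≡0) (zeroʳ x)))
    ... | no y≢0 | yes xy≡0 = ⊥-elim (y≢0 (x*y≡0⇒y≡0 x≢0 xy≡0))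
    ... | no _ | no _ = refl

    factor-0 : factor 0# ≡ 1#
    factor-0 with 0# ≟ 0#
    ... | yes _ = refl
    ... | no 0≢0 = ⊥-elim (0≢0 refl)

    factor-nonZero : ∀ y → y ≢ 0# → factor y ≡ x
    factor-nonZero y y≢0 with y ≟ 0#
    ... | yes y≡0 = ⊥-elim (y≢0 y≡0)
    ... | no _ = refl

    zeroIndex = index 0#

    factors : Product.sum (λ i → factor (element i)) ≡ x ^ m
    factors = begin
      Product.sum (λ i → factor (element i))
        ≡⟨ Product.sum-remove {i = zeroIndex} (λ i → factor (element i)) ⟩
      factor (element zeroIndex) * Product.sum (Vector.removeAt (λ i → factor (element i)) zeroIndex)
        ≡⟨ cong₂ _*_ (trans (cong factor (element-index 0#)) factor-0)
                     (Product.sum-cong-≗ {y = Vector.replicate m x} (λ j → factor-nonZero _ (λ eq → Fin.punchInᵢ≢i zeroIndex j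
                       (trans (sym (index-element _)) (cong index eq))))) ⟩
      1# * Product.sum (Vector.replicate m x)   ≡⟨ *-identityˡ _ ⟩
      Product.sum (Vector.replicate m x)        ≡⟨ Product.sum-replicate m ⟩
      x ^ m                                     ∎

  -- Translating by 1 permutes the field, so the sum of all elements gains (m+1)·1.
  characteristic : suc m ×ᵣ 1# ≡ 0#
  characteristic = sym (+-cancelˡ (trans (+-identityʳ S) (begin
    S                                            ≡⟨ Sum.sum-permute element shift ⟩
    Sum.sum (λ i → element (index (element i + 1#)))
      ≡⟨ Sum.sum-cong-≗ {x = λ i → element (index (element i + 1#))} (λ i → element-index _) ⟩
    Sum.sum (λ i → element i + 1#)               ≡⟨ Sum.∑-distrib-+ element (λ _ → 1#) ⟩
    S + Sum.sum (Vector.replicate (suc m) 1#)    ≡⟨ cong (S +_) (Sum.sum-replicate (suc m)) ⟩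
    S + suc m ×ᵣ 1#                              ∎)))
    where
    S = Sum.sum element

    shift : Permutation (suc m) (suc m)
    shift = bijection⇒permutation (_+ 1#) (_- 1#)
      (λ y → trans (+-assoc _ _ _) (trans (cong (y +_) (-‿inverseˡ 1#)) (+-identityʳ y)))
      (λ y → trans (+-assoc _ _ _) (trans (cong (y +_) (-‿inverseʳ 1#)) (+-identityʳ y)))

  x^[1+m]≡x : ∀ x → x ^ suc m ≡ x
  x^[1+m]≡x x with x ≟ 0#
  ... | yes x≡0 = trans (cong (_^ suc m) x≡0) (trans (zeroˡ _) (sym x≡0))
  ... | no x≢0 = trans (cong (x *_) (x^m≡1 x x≢0)) (*-identityʳ x)

prime⇒2≤ : ∀ {p} → Prime p → 2 ≤ p
prime⇒2≤ {0} p-prime = ⊥-elim (¬prime[0] p-prime)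
prime⇒2≤ {1} p-prime = ⊥-elim (¬prime[1] p-prime)
prime⇒2≤ {suc (suc _)} _ = s≤s (s≤s z≤n)

prime∤m! : ∀ {p} → Prime p → ∀ m → m < p → ¬ (p ∣ m !)
prime∤m! p-prime zero _ p∣1 = ¬prime[1] (subst Prime (∣1⇒≡1 p∣1) p-prime)
prime∤m! p-prime (suc m) m<p p∣m! with euclidsLemma (suc m) (m !) p-prime p∣m!
... | inj₁ p∣1+m = ℕ.<⇒≱ m<p (∣⇒≤ p∣1+m)
... | inj₂ p∣m!′ = prime∤m! p-prime m (ℕ.<-trans (ℕ.n<1+n m) m<p) p∣m!′

prime∣pCk : ∀ {p} → Prime p → ∀ k → 0 < k → k < p → p ∣ p C k
prime∣pCk {p} p-prime k 0<k k<p with euclidsLemma (p C k) (k ! ℕ.* (p ∸ k) !) p-prime p∣product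
  where
  instance _ = k ℕ.!* (p ∸ k) !≢0
  p∣product : p ∣ (p C k) ℕ.* (k ! ℕ.* (p ∸ k) !)
  p∣product = subst (p ∣_)
    (sym (trans (cong (ℕ._* (k ! ℕ.* (p ∸ k) !)) (nCk≡n!/k![n-k]! (ℕ.<⇒≤ k<p)))
                (m/n*n≡m (k![n∸k]!∣n! (ℕ.<⇒≤ k<p)))))
    (p∣p! p (prime⇒2≤ p-prime))
    where
    p∣p! : ∀ n → 2 ≤ n → n ∣ n !
    p∣p! (suc n) _ = m∣m*n (n !)
... | inj₁ p∣pCk = p∣pCk
... | inj₂ p∣k![p-k]! with euclidsLemma (k !) ((p ∸ k) !) p-prime p∣k![p-k]!
...   | inj₁ p∣k! = ⊥-elim (prime∤m! p-prime k k<p p∣k!)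
...   | inj₂ p∣[p-k]! = ⊥-elim (prime∤m! p-prime (p ∸ k) (ℕ.∸-monoʳ-< 0<k (ℕ.<⇒≤ k<p)) p∣[p-k]!)

module FieldAlgebra (F : Field) where
  open Field F
  open FieldProperties F
  open Solver
  open ≡-Reasoning

  evalPoly : List Carrier → Carrier → Carrier
  evalPoly [] x = 0#
  evalPoly (c ∷ cs) x = c + x * evalPoly cs x

  private
    quotient : Carrier → List Carrier → List Carrier
    quotient r [] = []
    quotient r (c ∷ cs) = evalPoly (c ∷ cs) r ∷ quotient r cs

    length-quotient : ∀ r cs → length (quotient r cs) ≡ length cs
    length-quotient r [] = refl
    length-quotient r (c ∷ cs) = cong suc (length-quotient r cs)

    factor-theorem : ∀ c cs x r →
      evalPoly (c ∷ cs) x - evalPoly (c ∷ cs) r ≡ (x - r) * evalPoly (quotient r cs) x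
    factor-theorem c [] x r =
      solve 3 (λ c x r → (c :+ x :* con 0ℤ) :- (c :+ r :* con 0ℤ) := (x :- r) :* con 0ℤ) refl c x r
    factor-theorem c (c′ ∷ cs) x r = begin
      (c + x * E x) - (c + r * E r)                         ≡⟨ cong (λ t → (c + x * t) - (c + r * E r)) Ex≡ ⟩
      (c + x * (E r + (x - r) * D)) - (c + r * E r)         ≡⟨ solve 5 (λ c x r Er D →
          (c :+ x :* (Er :+ (x :- r) :* D)) :- (c :+ r :* Er) := (x :- r) :* (Er :+ x :* D)) refl c x r (E r) D ⟩
      (x - r) * (E r + x * D)                               ∎
      where
      E = evalPoly (c′ ∷ cs)
      D = evalPoly (quotient r cs) x
      Ex≡ : E x ≡ E r + (x - r) * D
      Ex≡ = trans (solve 2 (λ a b → a := b :+ (a :- b)) refl (E x) (E r)) (cong (E r +_) (factor-theorem c′ cs x r))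

    evalPoly-zeros : ∀ cs x → All (_≡ 0#) cs → evalPoly cs x ≡ 0#
    evalPoly-zeros [] x [] = refl
    evalPoly-zeros (c ∷ cs) x (c≡0 ∷ cs≡0) = begin
      c + x * evalPoly cs x   ≡⟨ cong₂ (λ a b → a + x * b) c≡0 (evalPoly-zeros cs x cs≡0) ⟩
      0# + x * 0#             ≡⟨ solve 1 (λ x → con 0ℤ :+ x :* con 0ℤ := con 0ℤ) refl x ⟩
      0#                      ∎

    quotient-zero : ∀ r cs → All (_≡ 0#) (quotient r cs) → All (_≡ 0#) cs
    quotient-zero r [] _ = []
    quotient-zero r (c ∷ cs) (p[r]≡0 ∷ q≡0) = c≡0 ∷ cs≡0
      where
      cs≡0 = quotient-zero r cs q≡0
      c≡0 : c ≡ 0#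
      c≡0 = begin
        c                   ≡⟨ solve 2 (λ c r → c := c :+ r :* con 0ℤ) refl c r ⟩
        c + r * 0#          ≡⟨ cong (λ t → c + r * t) (evalPoly-zeros cs r cs≡0) ⟨
        evalPoly (c ∷ cs) r ≡⟨ p[r]≡0 ⟩
        0#                  ∎

  zero-of-too-many-roots : ∀ (rs cs : List Carrier) → length cs ≤ length rs → AllPairs _≢_ rs →
                           All (λ r → evalPoly cs r ≡ 0#) rs → All (_≡ 0#) cs
  zero-of-too-many-roots rs [] _ _ _ = []
  zero-of-too-many-roots (r ∷ rs) (c ∷ cs) (s≤s len≤) (r≢rs ∷ distinct) (p[r]≡0 ∷ p[rs]≡0) =
    quotient-zero r (c ∷ cs) (p[r]≡0 ∷ zero-of-too-many-roots rs (quotient r cs)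
      (subst (_≤ length rs) (sym (length-quotient r cs)) len≤) distinct (roots-of-quotient rs r≢rs p[rs]≡0))
    where
    roots-of-quotient : ∀ ss → All (r ≢_) ss → All (λ s → evalPoly (c ∷ cs) s ≡ 0#) ss →
                        All (λ s → evalPoly (quotient r cs) s ≡ 0#) ss
    roots-of-quotient [] _ _ = []
    roots-of-quotient (s ∷ ss) (r≢s ∷ r≢ss) (p[s]≡0 ∷ p[ss]≡0) =
      x*y≡0⇒y≡0 (x≢y⇒x-y≢0 (λ s≡r → r≢s (sym s≡r)))
        (trans (sym (factor-theorem c cs s r)) (trans (cong₂ _-_ p[s]≡0 p[r]≡0) (-‿inverseʳ 0#)))
      ∷ roots-of-quotient ss r≢ss p[ss]≡0

  module _ (_≟_ : (x y : Carrier) → Dec (x ≡ y)) where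

    nonRoot : ∀ {n} (f : Fin n → Carrier) → (∀ {i j} → f i ≡ f j → i ≡ j) →
              ∀ cs → length cs ≤ n → ¬ All (_≡ 0#) cs → ∃ λ j → evalPoly cs (f j) ≢ 0#
    nonRoot {n} f f-injective cs length≤n cs≢0 with Fin.any? (λ j → ¬? (evalPoly cs (f j) ≟ 0#))
    ... | yes nonroot = nonroot
    ... | no all-roots = ⊥-elim (cs≢0 (zero-of-too-many-roots (tabulate f) cs
          (subst (length cs ≤_) (sym (List.length-tabulate f)) length≤n)
          (Unique.tabulate⁺ f-injective)
          (All.tabulate⁺ λ j → decidable-stable (evalPoly cs (f j) ≟ 0#) (λ p≢0 → all-roots (j , p≢0)))))

  private
    module B = Binomial commutativeSemiring

    nC0≡1 : ∀ n → n C 0 ≡ 1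
    nC0≡1 n = trans (cong (n C_) (sym (ℕ.n∸n≡0 n))) (trans (sym (nCk≡nC[n∸k] {k = n} {n = n} ℕ.≤-refl)) (nCn≡1 n))

  module _ {p : ℕ} (p-prime : Prime p) (char-p : p ×ᵣ 1# ≡ 0#) where

    private
      p×x≡0 : ∀ x → p ×ᵣ x ≡ 0#
      p×x≡0 x = begin
        p ×ᵣ x          ≡⟨ cong (p ×ᵣ_) (*-identityˡ x) ⟨
        p ×ᵣ (1# * x)   ≡⟨ ×-assoc-* p 1# x ⟨
        (p ×ᵣ 1#) * x   ≡⟨ cong (_* x) char-p ⟩
        0# * x          ≡⟨ zeroˡ x ⟩
        0#              ∎

      inner-term≡0 : ∀ k → 0 < k → k < p → ∀ x → (p C k) ×ᵣ x ≡ 0#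
      inner-term≡0 k 0<k k<p x with prime∣pCk p-prime k 0<k k<p
      ... | divides t pCk≡t*p = begin
        (p C k) ×ᵣ x     ≡⟨ cong (_×ᵣ x) pCk≡t*p ⟩
        (t ℕ.* p) ×ᵣ x   ≡⟨ ×-assocˡ x t p ⟨
        t ×ᵣ (p ×ᵣ x)    ≡⟨ cong (t ×ᵣ_) (p×x≡0 x) ⟩
        t ×ᵣ 0#          ≡⟨ ×-zero t ⟩
        0#               ∎
        where
        ×-zero : ∀ t → t ×ᵣ 0# ≡ 0#
        ×-zero zero = refl
        ×-zero (suc t) = trans (+-identityˡ _) (×-zero t)

    freshman's-dream : ∀ x y → (x + y) ^ p ≡ x ^ p + y ^ p
    freshman's-dream x y = expand p refl (prime⇒2≤ p-prime)
      where
      expand : ∀ n → n ≡ p → 2 ≤ n → (x + y) ^ n ≡ x ^ n + y ^ n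
      expand n@(suc (suc m)) refl _ = begin
        (x + y) ^ n                                           ≡⟨ B.theorem n x y ⟩
        T Fin.zero + Sum.sum (λ j → T (Fin.suc j))            ≡⟨ cong (T Fin.zero +_) (Sum.sum-init-last (λ j → T (Fin.suc j))) ⟩
        T Fin.zero + (Sum.sum (Vector.init (λ j → T (Fin.suc j))) + T (Fin.suc (fromℕ (suc m))))
                                                              ≡⟨ cong₂ (λ a b → T Fin.zero + (a + b)) inner last ⟩
        T Fin.zero + (0# + x ^ n)                             ≡⟨ cong₂ _+_ first (+-identityˡ _) ⟩
        y ^ n + x ^ n                                         ≡⟨ +-comm _ _ ⟩
        x ^ n + y ^ n                                         ∎
        where
        module Sum = SemiringSum semiring
        T = B.binomialTerm x y n
        inner : Sum.sum (Vector.init (λ j → T (Fin.suc j))) ≡ 0#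
        inner = trans (Sum.sum-cong-≗ {x = Vector.init (λ j → T (Fin.suc j))} {y = Vector.replicate (suc m) 0#}
                        (λ j → inner-term≡0 (suc (toℕ (inject₁ j))) (s≤s z≤n)
                          (s≤s (subst (_< suc m) (sym (Fin.toℕ-inject₁ j)) (Fin.toℕ<n j))) _))
                      (Sum.sum-replicate-zero (suc m))
        last : T (Fin.suc (fromℕ (suc m))) ≡ x ^ n
        last = begin
          T (Fin.suc (fromℕ (suc m)))          ≡⟨ cong (λ k → (n C k) ×ᵣ (x ^ k * y ^ (n ∸ k))) (cong suc (Fin.toℕ-fromℕ (suc m))) ⟩
          (n C n) ×ᵣ (x ^ n * y ^ (n ∸ n))      ≡⟨ cong₂ (λ a b → a ×ᵣ (x ^ n * y ^ b)) (nCn≡1 n) (ℕ.n∸n≡0 n) ⟩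
          1 ×ᵣ (x ^ n * 1#)                     ≡⟨ +-identityʳ _ ⟩
          x ^ n * 1#                           ≡⟨ *-identityʳ _ ⟩
          x ^ n                                ∎
        first : T Fin.zero ≡ y ^ n
        first = begin
          (n C 0) ×ᵣ (1# * y ^ n)               ≡⟨ cong (_×ᵣ (1# * y ^ n)) (nC0≡1 n) ⟩
          1 ×ᵣ (1# * y ^ n)                     ≡⟨ +-identityʳ _ ⟩
          1# * y ^ n                           ≡⟨ *-identityˡ _ ⟩
          y ^ n                                ∎

    frobenius-+ : ∀ j x y → (x + y) ^ (p ℕ.^ j) ≡ x ^ (p ℕ.^ j) + y ^ (p ℕ.^ j)
    frobenius-+ zero x y = begin
      (x + y) ^ 1        ≡⟨ *-identityʳ _ ⟩
      x + y              ≡⟨ cong₂ _+_ (*-identityʳ x) (*-identityʳ y) ⟨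
      x ^ 1 + y ^ 1      ∎
    frobenius-+ (suc j) x y = begin
      (x + y) ^ (p ℕ.* p ℕ.^ j)              ≡⟨ ^-assocʳ (x + y) p (p ℕ.^ j) ⟨
      ((x + y) ^ p) ^ (p ℕ.^ j)              ≡⟨ cong (_^ (p ℕ.^ j)) (freshman's-dream x y) ⟩
      (x ^ p + y ^ p) ^ (p ℕ.^ j)            ≡⟨ frobenius-+ j (x ^ p) (y ^ p) ⟩
      (x ^ p) ^ (p ℕ.^ j) + (y ^ p) ^ (p ℕ.^ j)
                                             ≡⟨ cong₂ _+_ (^-assocʳ x p (p ℕ.^ j)) (^-assocʳ y p (p ℕ.^ j)) ⟩
      x ^ (p ℕ.* p ℕ.^ j) + y ^ (p ℕ.* p ℕ.^ j) ∎

  characteristic-of-power : (∀ x → Dec (x ≡ 0#)) → ∀ p j → (p ℕ.^ j) ×ᵣ 1# ≡ 0# → p ×ᵣ 1# ≡ 0#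
  characteristic-of-power _ p zero 1≡0 = ⊥-elim (1≢0 (trans (sym (+-identityʳ 1#)) 1≡0))
  characteristic-of-power zero? p (suc j) pʲ⁺¹≡0 with zero? (p ×ᵣ 1#)
  ... | yes p≡0 = p≡0
  ... | no p≢0 = characteristic-of-power zero? p j (x*y≡0⇒y≡0 p≢0 (trans (sym (×1-homo-* p (p ℕ.^ j))) pʲ⁺¹≡0))

module Space (F : Field) where
  open Field F
  open FieldProperties F
  open Solver
  open ≡-Reasoning

  vec3 : Carrier → Carrier → Carrier → Vec3 F
  vec3 a b c = vec (λ { Fin.zero → a ; (Fin.suc Fin.zero) → b ; (Fin.suc (Fin.suc Fin.zero)) → c })

  x0 x1 x2 : Vec3 F → Carrier
  x0 v = coord v i0
  x1 v = coord v i1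
  x2 v = coord v i2

  fin3-cases : ∀ {P : Fin 3 → Set} → P i0 → P i1 → P i2 → ∀ i → P i
  fin3-cases p0 p1 p2 Fin.zero = p0
  fin3-cases p0 p1 p2 (Fin.suc Fin.zero) = p1
  fin3-cases p0 p1 p2 (Fin.suc (Fin.suc Fin.zero)) = p2

  infix 4 _≐_
  record _≐_ (u v : Vec3 F) : Set where
    constructor coordwise
    field at : ∀ i → coord u i ≡ coord v i
  open _≐_ public

  ≐-refl : ∀ {u} → u ≐ u
  ≐-refl = coordwise λ _ → refl

  ≐-sym : ∀ {u v} → u ≐ v → v ≐ u
  ≐-sym u≐v = coordwise λ i → sym (at u≐v i)

  ≐-trans : ∀ {u v w} → u ≐ v → v ≐ w → u ≐ w
  ≐-trans u≐v v≐w = coordwise λ i → trans (at u≐v i) (at v≐w i)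

  cong₃ : ∀ {A B C D : Set} (f : A → B → C → D) {a a′ b b′ c c′} →
          a ≡ a′ → b ≡ b′ → c ≡ c′ → f a b c ≡ f a′ b′ c′
  cong₃ f refl refl refl = refl

  -- Functions that only inspect the three coordinates (det3, eval, _·_, …) do not
  -- distinguish a vector u from its normal form, so u ≐ v turns into u ≡ v there.
  normal : Vec3 F → Vec3 F
  normal u = vec3 (x0 u) (x1 u) (x2 u)

  ≐⇒normal≡ : ∀ {u v} → u ≐ v → normal u ≡ normal v
  ≐⇒normal≡ u≐v = cong₃ vec3 (at u≐v i0) (at u≐v i1) (at u≐v i2)

  Zero : Vec3 F → Set
  Zero v = ∀ i → coord v i ≡ 0#

  scale : Carrier → Vec3 F → Vec3 F
  scale s v = vec (λ i → s * coord v i)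

  infixl 6 _⊕_
  _⊕_ : Vec3 F → Vec3 F → Vec3 F
  u ⊕ v = vec (λ i → coord u i + coord v i)

  zeroVec : Vec3 F
  zeroVec = vec (λ _ → 0#)

  scale-cong : ∀ s {u v} → u ≐ v → scale s u ≐ scale s v
  scale-cong s u≐v = coordwise λ i → cong (s *_) (at u≐v i)

  scale-scale : ∀ s t v → scale s (scale t v) ≐ scale (s * t) v
  scale-scale s t v = coordwise λ i → sym (*-assoc s t (coord v i))

  dot : Vec3 F → Vec3 F → Carrier
  dot u v = x0 u * x0 v + x1 u * x1 v + x2 u * x2 v

  cross : Vec3 F → Vec3 F → Vec3 F
  cross u v = vec3 (x1 u * x2 v - x2 u * x1 v) (x2 u * x0 v - x0 u * x2 v) (x0 u * x1 v - x1 u * x0 v)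

  row : Mat3 F → Fin 3 → Vec3 F
  row A i = vec (entry A i)

  detM : Mat3 F → Carrier
  detM A = det3 (row A i0) (row A i1) (row A i2)

  det3-cong : ∀ {u u′ v v′ w w′} → u ≐ u′ → v ≐ v′ → w ≐ w′ → det3 u v w ≡ det3 u′ v′ w′
  det3-cong u≐u′ v≐v′ w≐w′ = cong₃ det3 (≐⇒normal≡ u≐u′) (≐⇒normal≡ v≐v′) (≐⇒normal≡ w≐w′)

  det3-scale₁ : ∀ s u v w → det3 (scale s u) v w ≡ s * det3 u v w
  det3-scale₁ s u v w = solve 10 (λ s a b c d e f g h i →
      (s :* a) :* (e :* i :- f :* h) :- (s :* b) :* (d :* i :- f :* g) :+ (s :* c) :* (d :* h :- e :* g)
      := s :* (a :* (e :* i :- f :* h) :- b :* (d :* i :- f :* g) :+ c :* (d :* h :- e :* g))) refl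
    s (x0 u) (x1 u) (x2 u) (x0 v) (x1 v) (x2 v) (x0 w) (x1 w) (x2 w)

  det3-rotate : ∀ u v w → det3 u v w ≡ det3 w u v
  det3-rotate u v w = solve 9 (λ a b c d e f g h i →
      a :* (e :* i :- f :* h) :- b :* (d :* i :- f :* g) :+ c :* (d :* h :- e :* g)
      := g :* (b :* f :- c :* e) :- h :* (a :* f :- c :* d) :+ i :* (a :* e :- b :* d)) refl
    (x0 u) (x1 u) (x2 u) (x0 v) (x1 v) (x2 v) (x0 w) (x1 w) (x2 w)

  det3-scale₂ : ∀ s u v w → det3 u (scale s v) w ≡ s * det3 u v w
  det3-scale₂ s u v w = begin
    det3 u (scale s v) w    ≡⟨ det3-rotate u (scale s v) w ⟩
    det3 w u (scale s v)    ≡⟨ det3-rotate w u (scale s v) ⟩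
    det3 (scale s v) w u    ≡⟨ det3-scale₁ s v w u ⟩
    s * det3 v w u          ≡⟨ cong (s *_) (det3-rotate v w u) ⟩
    s * det3 u v w          ∎

  det3-scale₃ : ∀ s u v w → det3 u v (scale s w) ≡ s * det3 u v w
  det3-scale₃ s u v w = begin
    det3 u v (scale s w)    ≡⟨ det3-rotate u v (scale s w) ⟩
    det3 (scale s w) u v    ≡⟨ det3-scale₁ s w u v ⟩
    s * det3 w u v          ≡⟨ cong (s *_) (det3-rotate u v w) ⟨
    s * det3 u v w          ∎

  det3≡dot-cross : ∀ u v w → det3 u v w ≡ dot u (cross v w)
  det3≡dot-cross u v w = solve 9 (λ a b c d e f g h i →
      a :* (e :* i :- f :* h) :- b :* (d :* i :- f :* g) :+ c :* (d :* h :- e :* g)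
      := a :* (e :* i :- f :* h) :+ b :* (f :* g :- d :* i) :+ c :* (d :* h :- e :* g)) refl
    (x0 u) (x1 u) (x2 u) (x0 v) (x1 v) (x2 v) (x0 w) (x1 w) (x2 w)

  det3-transpose : ∀ u v w →
    det3 (vec3 (x0 u) (x0 v) (x0 w)) (vec3 (x1 u) (x1 v) (x1 w)) (vec3 (x2 u) (x2 v) (x2 w)) ≡ det3 u v w
  det3-transpose u v w = solve 9 (λ a b c d e f g h i →
      a :* (e :* i :- h :* f) :- d :* (b :* i :- h :* c) :+ g :* (b :* f :- e :* c)
      := a :* (e :* i :- f :* h) :- b :* (d :* i :- f :* g) :+ c :* (d :* h :- e :* g)) refl
    (x0 u) (x1 u) (x2 u) (x0 v) (x1 v) (x2 v) (x0 w) (x1 w) (x2 w)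

  ·-cong : ∀ A {u v} → u ≐ v → A · u ≐ A · v
  ·-cong A u≐v = coordwise λ i → cong (λ x → coord (A · x) i) (≐⇒normal≡ u≐v)

  ⊗-· : ∀ A B v → (A ⊗ B) · v ≐ A · (B · v)
  ⊗-· A B v = coordwise λ i → solve 15 (λ a0 a1 a2 b00 b01 b02 b10 b11 b12 b20 b21 b22 v0 v1 v2 →
      (a0 :* b00 :+ a1 :* b10 :+ a2 :* b20) :* v0 :+ (a0 :* b01 :+ a1 :* b11 :+ a2 :* b21) :* v1
        :+ (a0 :* b02 :+ a1 :* b12 :+ a2 :* b22) :* v2
      := a0 :* (b00 :* v0 :+ b01 :* v1 :+ b02 :* v2) :+ a1 :* (b10 :* v0 :+ b11 :* v1 :+ b12 :* v2)
        :+ a2 :* (b20 :* v0 :+ b21 :* v1 :+ b22 :* v2)) refl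
    (entry A i i0) (entry A i i1) (entry A i i2)
    (entry B i0 i0) (entry B i0 i1) (entry B i0 i2) (entry B i1 i0) (entry B i1 i1) (entry B i1 i2)
    (entry B i2 i0) (entry B i2 i1) (entry B i2 i2) (x0 v) (x1 v) (x2 v)

  I3-· : ∀ v → I3 · v ≐ v
  I3-· v = coordwise (fin3-cases
    (solve 3 (λ a b c → con 1ℤ :* a :+ con 0ℤ :* b :+ con 0ℤ :* c := a) refl (x0 v) (x1 v) (x2 v))
    (solve 3 (λ a b c → con 0ℤ :* a :+ con 1ℤ :* b :+ con 0ℤ :* c := b) refl (x0 v) (x1 v) (x2 v))
    (solve 3 (λ a b c → con 0ℤ :* a :+ con 0ℤ :* b :+ con 1ℤ :* c := c) refl (x0 v) (x1 v) (x2 v)))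

  ·-scale : ∀ A s v → A · scale s v ≐ scale s (A · v)
  ·-scale A s v = coordwise λ i → solve 7 (λ a0 a1 a2 s v0 v1 v2 →
      a0 :* (s :* v0) :+ a1 :* (s :* v1) :+ a2 :* (s :* v2) := s :* (a0 :* v0 :+ a1 :* v1 :+ a2 :* v2)) refl
    (entry A i i0) (entry A i i1) (entry A i i2) s (x0 v) (x1 v) (x2 v)

  ·-⊕ : ∀ A u v → A · (u ⊕ v) ≐ A · u ⊕ A · v
  ·-⊕ A u v = coordwise λ i → solve 9 (λ a0 a1 a2 u0 u1 u2 v0 v1 v2 →
      a0 :* (u0 :+ v0) :+ a1 :* (u1 :+ v1) :+ a2 :* (u2 :+ v2)
      := (a0 :* u0 :+ a1 :* u1 :+ a2 :* u2) :+ (a0 :* v0 :+ a1 :* v1 :+ a2 :* v2)) refl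
    (entry A i i0) (entry A i i1) (entry A i i2) (x0 u) (x1 u) (x2 u) (x0 v) (x1 v) (x2 v)

  ·-zeroVec : ∀ A → A · zeroVec ≐ zeroVec
  ·-zeroVec A = coordwise λ i → solve 3 (λ a0 a1 a2 →
      a0 :* con 0ℤ :+ a1 :* con 0ℤ :+ a2 :* con 0ℤ := con 0ℤ) refl (entry A i i0) (entry A i i1) (entry A i i2)

  ·-cong-entries : ∀ {A B} → (∀ i j → entry A i j ≡ entry B i j) → ∀ v → A · v ≐ B · v
  ·-cong-entries A≡B v = coordwise λ i →
    cong₃ (λ a b c → a * x0 v + b * x1 v + c * x2 v) (A≡B i i0) (A≡B i i1) (A≡B i i2)

  ^ᴹ-suc-· : ∀ A n v → (A ^ᴹ suc n) · v ≐ (A ^ᴹ n) · (A · v)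
  ^ᴹ-suc-· A zero v = ≐-trans (⊗-· A I3 v) (≐-trans (·-cong A (I3-· v)) (≐-sym (I3-· (A · v))))
  ^ᴹ-suc-· A (suc n) v = ≐-trans (⊗-· A (A ^ᴹ suc n) v)
    (≐-trans (·-cong A (^ᴹ-suc-· A n v)) (≐-sym (⊗-· A (A ^ᴹ n) (A · v))))

  ^ᴹ-+-· : ∀ A a b v → (A ^ᴹ (a ℕ.+ b)) · v ≐ (A ^ᴹ a) · ((A ^ᴹ b) · v)
  ^ᴹ-+-· A zero b v = ≐-sym (I3-· _)
  ^ᴹ-+-· A (suc a) b v = ≐-trans (⊗-· A (A ^ᴹ (a ℕ.+ b)) v)
    (≐-trans (·-cong A (^ᴹ-+-· A a b v)) (≐-sym (⊗-· A (A ^ᴹ a) ((A ^ᴹ b) · v))))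

  scalar-· : ∀ A s → (∀ i j → entry A i j ≡ s * entry (I3 {F}) i j) → ∀ v → A · v ≐ scale s v
  scalar-· A s A≡sI v = coordwise λ i → begin
    coord (A · v) i
      ≡⟨ cong₃ (λ a b c → a * x0 v + b * x1 v + c * x2 v) (A≡sI i i0) (A≡sI i i1) (A≡sI i i2) ⟩
    s * entry (I3 {F}) i i0 * x0 v + s * entry (I3 {F}) i i1 * x1 v + s * entry (I3 {F}) i i2 * x2 v
      ≡⟨ solve 7 (λ s a b c x y z → s :* a :* x :+ s :* b :* y :+ s :* c :* z := s :* (a :* x :+ b :* y :+ c :* z)) refl
           s (entry (I3 {F}) i i0) (entry (I3 {F}) i i1) (entry (I3 {F}) i i2) (x0 v) (x1 v) (x2 v) ⟩
    s * coord (I3 · v) i   ≡⟨ cong (s *_) (at (I3-· v) i) ⟩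
    s * coord v i          ∎

  column : Fin 3 → Vec3 F
  column j = vec (λ k → entry (I3 {F}) k j)

  scalar-action⇒scalar : ∀ A s → (∀ v → A · v ≐ scale s v) → ∀ i j → entry A i j ≡ s * entry (I3 {F}) i j
  scalar-action⇒scalar A s A≐s i j = trans (entry≡column j) (at (A≐s (column j)) i)
    where
    entry≡column : ∀ j → entry A i j ≡ coord (A · column j) i
    entry≡column = fin3-cases
      (solve 3 (λ a b c → a := a :* con 1ℤ :+ b :* con 0ℤ :+ c :* con 0ℤ) refl (entry A i i0) (entry A i i1) (entry A i i2))
      (solve 3 (λ a b c → b := a :* con 0ℤ :+ b :* con 1ℤ :+ c :* con 0ℤ) refl (entry A i i0) (entry A i i1) (entry A i i2))
      (solve 3 (λ a b c → c := a :* con 0ℤ :+ b :* con 0ℤ :+ c :* con 1ℤ) refl (entry A i i0) (entry A i i1) (entry A i i2))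

  det3-· : ∀ A u v w → det3 (A · u) (A · v) (A · w) ≡ detM A * det3 u v w
  det3-· A u v w = solve 18 (λ a b c d e f g h i u0 u1 u2 v0 v1 v2 w0 w1 w2 → let
      dt : _ → _ → _ → _ → _ → _ → _ → _ → _ → _
      dt a b c d e f g h i = a :* (e :* i :- f :* h) :- b :* (d :* i :- f :* g) :+ c :* (d :* h :- e :* g)
    in dt (a :* u0 :+ b :* u1 :+ c :* u2) (d :* u0 :+ e :* u1 :+ f :* u2) (g :* u0 :+ h :* u1 :+ i :* u2)
          (a :* v0 :+ b :* v1 :+ c :* v2) (d :* v0 :+ e :* v1 :+ f :* v2) (g :* v0 :+ h :* v1 :+ i :* v2)
          (a :* w0 :+ b :* w1 :+ c :* w2) (d :* w0 :+ e :* w1 :+ f :* w2) (g :* w0 :+ h :* w1 :+ i :* w2)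
       := dt a b c d e f g h i :* dt u0 u1 u2 v0 v1 v2 w0 w1 w2) refl
    (entry A i0 i0) (entry A i0 i1) (entry A i0 i2) (entry A i1 i0) (entry A i1 i1) (entry A i1 i2)
    (entry A i2 i0) (entry A i2 i1) (entry A i2 i2)
    (x0 u) (x1 u) (x2 u) (x0 v) (x1 v) (x2 v) (x0 w) (x1 w) (x2 w)

  _-ᴵ_ : Mat3 F → Carrier → Mat3 F
  A -ᴵ a = mat (λ i j → entry A i j - a * entry (I3 {F}) i j)

  -ᴵ-· : ∀ A a v i → coord ((A -ᴵ a) · v) i ≡ coord (A · v) i - a * coord v i
  -ᴵ-· A a v i = begin
    coord ((A -ᴵ a) · v) i
      ≡⟨ solve 10 (λ a m0 m1 m2 e0 e1 e2 v0 v1 v2 →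
           (m0 :- a :* e0) :* v0 :+ (m1 :- a :* e1) :* v1 :+ (m2 :- a :* e2) :* v2
           := (m0 :* v0 :+ m1 :* v1 :+ m2 :* v2) :- a :* (e0 :* v0 :+ e1 :* v1 :+ e2 :* v2)) refl
         a (entry A i i0) (entry A i i1) (entry A i i2) (entry (I3 {F}) i i0) (entry (I3 {F}) i i1) (entry (I3 {F}) i i2)
         (x0 v) (x1 v) (x2 v) ⟩
    coord (A · v) i - a * coord (I3 · v) i  ≡⟨ cong (λ t → coord (A · v) i - a * t) (at (I3-· v) i) ⟩
    coord (A · v) i - a * coord v i         ∎

  diag : Carrier → Carrier → Carrier → Vec3 F → Vec3 F
  diag l1 l2 l3 v = vec3 (l1 * x0 v) (l2 * x1 v) (l3 * x2 v)

  diag-cong : ∀ l1 l2 l3 {u v} → u ≐ v → diag l1 l2 l3 u ≐ diag l1 l2 l3 v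
  diag-cong l1 l2 l3 u≐v = coordwise λ i → cong (λ x → coord (diag l1 l2 l3 x) i) (≐⇒normal≡ u≐v)

  diag-scale : ∀ l1 l2 l3 s v → diag l1 l2 l3 (scale s v) ≐ scale s (diag l1 l2 l3 v)
  diag-scale l1 l2 l3 s v = coordwise (fin3-cases (swap l1 (x0 v)) (swap l2 (x1 v)) (swap l3 (x2 v)))
    where
    swap : ∀ l x → l * (s * x) ≡ s * (l * x)
    swap l x = solve 3 (λ l s x → l :* (s :* x) := s :* (l :* x)) refl l s x

  diag-cancel : ∀ {l1 l2 l3 s u v} → l1 ≢ 0# → l2 ≢ 0# → l3 ≢ 0# →
    diag l1 l2 l3 u ≐ scale s (diag l1 l2 l3 v) → u ≐ scale s v
  diag-cancel {l1} {l2} {l3} {s} {u} {v} l1≢0 l2≢0 l3≢0 Λu≐sΛv =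
    coordwise (fin3-cases (cancel l1≢0 (at Λu≐sΛv i0)) (cancel l2≢0 (at Λu≐sΛv i1)) (cancel l3≢0 (at Λu≐sΛv i2)))
    where
    cancel : ∀ {l x y} → l ≢ 0# → l * x ≡ s * (l * y) → x ≡ s * y
    cancel {l} {x} {y} l≢0 eq = *-cancelˡ l≢0 (trans eq (solve 3 (λ s l y → s :* (l :* y) := l :* (s :* y)) refl s l y))

  det3-diag : ∀ l1 l2 l3 u v w →
    det3 (diag l1 l2 l3 u) (diag l1 l2 l3 v) (diag l1 l2 l3 w) ≡ l1 * l2 * l3 * det3 u v w
  det3-diag l1 l2 l3 u v w = solve 12 (λ l1 l2 l3 a b c d e f g h i → let
      dt : _ → _ → _ → _ → _ → _ → _ → _ → _ → _
      dt a b c d e f g h i = a :* (e :* i :- f :* h) :- b :* (d :* i :- f :* g) :+ c :* (d :* h :- e :* g)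
    in dt (l1 :* a) (l2 :* b) (l3 :* c) (l1 :* d) (l2 :* e) (l3 :* f) (l1 :* g) (l2 :* h) (l3 :* i)
       := l1 :* l2 :* l3 :* dt a b c d e f g h i) refl
    l1 l2 l3 (x0 u) (x1 u) (x2 u) (x0 v) (x1 v) (x2 v) (x0 w) (x1 w) (x2 w)

  proportional-by-minors : ∀ X Y (Y0≢0 : x0 Y ≢ 0#) →
    x0 X * x1 Y ≡ x1 X * x0 Y → x0 X * x2 Y ≡ x2 X * x0 Y → X ≐ scale (x0 X * x0 Y ⁻¹⟨ Y0≢0 ⟩) Y
  proportional-by-minors X Y Y0≢0 minor₁ minor₂ = coordwise (fin3-cases
    (from-minor (x0 X) refl) (from-minor (x1 X) (sym minor₁)) (from-minor (x2 X) (sym minor₂)))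
    where
    from-minor : ∀ {Yi} Xi → Xi * x0 Y ≡ x0 X * Yi → Xi ≡ (x0 X * x0 Y ⁻¹⟨ Y0≢0 ⟩) * Yi
    from-minor {Yi} Xi eq = begin
      Xi                                     ≡⟨ *-identityʳ Xi ⟨
      Xi * 1#                                ≡⟨ cong (Xi *_) (inverseʳ (x0 Y) Y0≢0) ⟨
      Xi * (x0 Y * x0 Y ⁻¹⟨ Y0≢0 ⟩)          ≡⟨ *-assoc _ _ _ ⟨
      (Xi * x0 Y) * x0 Y ⁻¹⟨ Y0≢0 ⟩          ≡⟨ cong (_* x0 Y ⁻¹⟨ Y0≢0 ⟩) eq ⟩
      (x0 X * Yi) * x0 Y ⁻¹⟨ Y0≢0 ⟩          ≡⟨ solve 3 (λ a b c → (a :* b) :* c := (a :* c) :* b) refl (x0 X) Yi _ ⟩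
      (x0 X * x0 Y ⁻¹⟨ Y0≢0 ⟩) * Yi          ∎

  rescale : ∀ {u v w s θ} (θ≢0 : θ ≢ 0#) → u ≐ scale θ v → w ≐ scale s v → w ≐ scale (s * θ ⁻¹⟨ θ≢0 ⟩) u
  rescale {u} {v} {w} {s} {θ} θ≢0 u≐θv w≐sv = coordwise λ i → begin
    coord w i                                    ≡⟨ at w≐sv i ⟩
    s * coord v i                                ≡⟨ cong (s *_) (*-identityˡ _) ⟨
    s * (1# * coord v i)                         ≡⟨ cong (λ t → s * (t * coord v i)) (inverseˡ θ θ≢0) ⟨
    s * (θ ⁻¹⟨ θ≢0 ⟩ * θ * coord v i)            ≡⟨ solve 4 (λ s i θ v → s :* (i :* θ :* v) := (s :* i) :* (θ :* v)) refl s _ θ (coord v i) ⟩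
    (s * θ ⁻¹⟨ θ≢0 ⟩) * (θ * coord v i)          ≡⟨ cong ((s * θ ⁻¹⟨ θ≢0 ⟩) *_) (at u≐θv i) ⟨
    (s * θ ⁻¹⟨ θ≢0 ⟩) * coord u i                ∎

  eval-cong : ∀ G {u v} → u ≐ v → eval G u ≡ eval G v
  eval-cong G u≐v = cong (eval G) (≐⇒normal≡ u≐v)

  eval-scale : ∀ G s v → eval G (scale s v) ≡ s * s * eval G v
  eval-scale (qform a b c d e f) s v = solve 10 (λ a b c d e f s x y z →
      a :* (s :* x) :* (s :* x) :+ b :* (s :* y) :* (s :* y) :+ c :* (s :* z) :* (s :* z)
        :+ d :* (s :* x) :* (s :* y) :+ e :* (s :* x) :* (s :* z) :+ f :* (s :* y) :* (s :* z)
      := s :* s :* (a :* x :* x :+ b :* y :* y :+ c :* z :* z :+ d :* x :* y :+ e :* x :* z :+ f :* y :* z)) refl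
    a b c d e f s (x0 v) (x1 v) (x2 v)

  polar : QForm F → Vec3 F → Vec3 F → Carrier
  polar G u v = eval G (u ⊕ v) - eval G u - eval G v

  -- the conics through the vertices of the triangle of reference
  triangleForm : Carrier → Carrier → Carrier → Vec3 F → Carrier
  triangleForm a b c v = a * (x1 v * x2 v) + b * (x0 v * x2 v) + c * (x0 v * x1 v)

  vanishing⇒disc≡0 : ∀ Q → (∀ P → eval Q P ≡ 0#) → disc Q ≡ 0#
  vanishing⇒disc≡0 Q@(qform a b c d e f) Q≡0 = begin
    disc {F} Q                           ≡⟨ cong₃ (λ a b c → disc {F} (qform a b c d e f)) a≡0 b≡0 c≡0 ⟩
    disc {F} (qform 0# 0# 0# d e f)      ≡⟨ cong₃ (λ d e f → disc {F} (qform 0# 0# 0# d e f)) d≡0 e≡0 f≡0 ⟩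
    disc {F} (qform 0# 0# 0# 0# 0# 0#)   ≡⟨ solve 1 (λ k → k :* con 0ℤ :* con 0ℤ :* con 0ℤ :- con 0ℤ :* con 0ℤ :* con 0ℤ
        :- con 0ℤ :* con 0ℤ :* con 0ℤ :- con 0ℤ :* con 0ℤ :* con 0ℤ :+ con 0ℤ :* con 0ℤ :* con 0ℤ := con 0ℤ) refl
        (1# + 1# + 1# + 1#) ⟩
    0#                        ∎
    where
    at-point : ∀ x y z → eval Q (vec3 x y z) ≡ 0#
    at-point x y z = Q≡0 (vec3 x y z)

    a≡0 : a ≡ 0#
    a≡0 = trans (solve 6 (λ a b c d e f → a := a :* con 1ℤ :* con 1ℤ :+ b :* con 0ℤ :* con 0ℤ :+ c :* con 0ℤ :* con 0ℤ
        :+ d :* con 1ℤ :* con 0ℤ :+ e :* con 1ℤ :* con 0ℤ :+ f :* con 0ℤ :* con 0ℤ) refl a b c d e f) (at-point 1# 0# 0#)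
    b≡0 : b ≡ 0#
    b≡0 = trans (solve 6 (λ a b c d e f → b := a :* con 0ℤ :* con 0ℤ :+ b :* con 1ℤ :* con 1ℤ :+ c :* con 0ℤ :* con 0ℤ
        :+ d :* con 0ℤ :* con 1ℤ :+ e :* con 0ℤ :* con 0ℤ :+ f :* con 1ℤ :* con 0ℤ) refl a b c d e f) (at-point 0# 1# 0#)
    c≡0 : c ≡ 0#
    c≡0 = trans (solve 6 (λ a b c d e f → c := a :* con 0ℤ :* con 0ℤ :+ b :* con 0ℤ :* con 0ℤ :+ c :* con 1ℤ :* con 1ℤ
        :+ d :* con 0ℤ :* con 0ℤ :+ e :* con 0ℤ :* con 1ℤ :+ f :* con 0ℤ :* con 1ℤ) refl a b c d e f) (at-point 0# 0# 1#)

    mixed≡0 : ∀ {u v w} → u ≡ 0# → v ≡ 0# → u + v + w ≡ 0# → w ≡ 0#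
    mixed≡0 {u} {v} {w} refl refl u+v+w≡0 = trans (solve 1 (λ w → w := con 0ℤ :+ con 0ℤ :+ w) refl w) u+v+w≡0

    d≡0 : d ≡ 0#
    d≡0 = mixed≡0 a≡0 b≡0 (trans (solve 6 (λ a b c d e f → a :+ b :+ d := a :* con 1ℤ :* con 1ℤ :+ b :* con 1ℤ :* con 1ℤ
        :+ c :* con 0ℤ :* con 0ℤ :+ d :* con 1ℤ :* con 1ℤ :+ e :* con 1ℤ :* con 0ℤ :+ f :* con 1ℤ :* con 0ℤ) refl a b c d e f) (at-point 1# 1# 0#))
    e≡0 : e ≡ 0#
    e≡0 = mixed≡0 a≡0 c≡0 (trans (solve 6 (λ a b c d e f → a :+ c :+ e := a :* con 1ℤ :* con 1ℤ :+ b :* con 0ℤ :* con 0ℤ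
        :+ c :* con 1ℤ :* con 1ℤ :+ d :* con 1ℤ :* con 0ℤ :+ e :* con 1ℤ :* con 1ℤ :+ f :* con 0ℤ :* con 1ℤ) refl a b c d e f) (at-point 1# 0# 1#))
    f≡0 : f ≡ 0#
    f≡0 = mixed≡0 b≡0 c≡0 (trans (solve 6 (λ a b c d e f → b :+ c :+ f := a :* con 0ℤ :* con 0ℤ :+ b :* con 1ℤ :* con 1ℤ
        :+ c :* con 1ℤ :* con 1ℤ :+ d :* con 0ℤ :* con 1ℤ :+ e :* con 0ℤ :* con 1ℤ :+ f :* con 1ℤ :* con 1ℤ) refl a b c d e f) (at-point 0# 1# 1#))

  OnConic-∼ : ∀ {Q : QForm F} {P R} → P ∼ R → OnConic Q R → OnConic Q P
  OnConic-∼ {Q} {P} {R} (t , _ , P≡tR) R∈Q = begin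
    eval Q P               ≡⟨ eval-cong Q {P} {scale t R} (coordwise P≡tR) ⟩
    eval Q (scale t R)     ≡⟨ eval-scale Q t R ⟩
    t * t * eval Q R       ≡⟨ cong (t * t *_) R∈Q ⟩
    t * t * 0#             ≡⟨ zeroʳ _ ⟩
    0#                     ∎

  private
    dot-comm : ∀ u v → dot u v ≡ dot v u
    dot-comm u v = solve 6 (λ a b c d e f → a :* d :+ b :* e :+ c :* f := d :* a :+ e :* b :+ f :* c) refl
      (x0 u) (x1 u) (x2 u) (x0 v) (x1 v) (x2 v)

    dot-zeroʳ : ∀ u v → Zero v → dot u v ≡ 0#
    dot-zeroʳ u v v≡0 = begin
      dot u v                              ≡⟨ cong (dot u) (≐⇒normal≡ (coordwise v≡0)) ⟩
      x0 u * 0# + x1 u * 0# + x2 u * 0#    ≡⟨ solve 3 (λ a b c → a :* con 0ℤ :+ b :* con 0ℤ :+ c :* con 0ℤ := con 0ℤ) refl (x0 u) (x1 u) (x2 u) ⟩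
      0#                                   ∎

    dot-cross-self₁ : ∀ a b → dot a (cross a b) ≡ 0#
    dot-cross-self₁ a b = solve 6 (λ a0 a1 a2 b0 b1 b2 →
        a0 :* (a1 :* b2 :- a2 :* b1) :+ a1 :* (a2 :* b0 :- a0 :* b2) :+ a2 :* (a0 :* b1 :- a1 :* b0) := con 0ℤ) refl
      (x0 a) (x1 a) (x2 a) (x0 b) (x1 b) (x2 b)

    dot-cross-self₂ : ∀ a b → dot b (cross a b) ≡ 0#
    dot-cross-self₂ a b = solve 6 (λ a0 a1 a2 b0 b1 b2 →
        b0 :* (a1 :* b2 :- a2 :* b1) :+ b1 :* (a2 :* b0 :- a0 :* b2) :+ b2 :* (a0 :* b1 :- a1 :* b0) := con 0ℤ) refl
      (x0 a) (x1 a) (x2 a) (x0 b) (x1 b) (x2 b)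

    dot-cross-rotate : ∀ a b c → dot a (cross b c) ≡ dot c (cross a b)
    dot-cross-rotate a b c = trans (sym (det3≡dot-cross a b c)) (trans (det3-rotate a b c) (det3≡dot-cross c a b))

    cross-self : ∀ a → Zero (cross a a)
    cross-self a = fin3-cases (x*y-y*x≡0 (x1 a) (x2 a)) (x*y-y*x≡0 (x2 a) (x0 a)) (x*y-y*x≡0 (x0 a) (x1 a))
      where
      x*y-y*x≡0 : ∀ u v → u * v - v * u ≡ 0#
      x*y-y*x≡0 u v = trans (cong (λ t → u * v - t) (*-comm v u)) (-‿inverseʳ _)

    cross-swap : ∀ a b → Zero (cross a b) → Zero (cross b a)
    cross-swap a b ab≡0 = fin3-cases
      (trans (solve 4 (λ a1 a2 b1 b2 → b1 :* a2 :- b2 :* a1 := :- (a1 :* b2 :- a2 :* b1)) refl (x1 a) (x2 a) (x1 b) (x2 b)) (-≡0 (ab≡0 i0)))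
      (trans (solve 4 (λ a0 a2 b0 b2 → b2 :* a0 :- b0 :* a2 := :- (a2 :* b0 :- a0 :* b2)) refl (x0 a) (x2 a) (x0 b) (x2 b)) (-≡0 (ab≡0 i1)))
      (trans (solve 4 (λ a0 a1 b0 b1 → b0 :* a1 :- b1 :* a0 := :- (a0 :* b1 :- a1 :* b0)) refl (x0 a) (x1 a) (x0 b) (x1 b)) (-≡0 (ab≡0 i2)))
      where
      -≡0 : ∀ {x} → x ≡ 0# → - x ≡ 0#
      -≡0 x≡0 = trans (cong -_ x≡0) -0#≈0#

    adjugate : ∀ r0 r1 r2 w i → det3 r0 r1 r2 * coord w i ≡
      dot r0 w * coord (cross r1 r2) i + dot r1 w * coord (cross r2 r0) i + dot r2 w * coord (cross r0 r1) i
    adjugate r0 r1 r2 w = fin3-cases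
      (solve 12 (λ a b c d e f g h i p q r → (a :* (e :* i :- f :* h) :- b :* (d :* i :- f :* g) :+ c :* (d :* h :- e :* g)) :* p
         := (a :* p :+ b :* q :+ c :* r) :* (e :* i :- f :* h) :+ (d :* p :+ e :* q :+ f :* r) :* (h :* c :- i :* b)
            :+ (g :* p :+ h :* q :+ i :* r) :* (b :* f :- c :* e)) refl
         (x0 r0) (x1 r0) (x2 r0) (x0 r1) (x1 r1) (x2 r1) (x0 r2) (x1 r2) (x2 r2) (x0 w) (x1 w) (x2 w))
      (solve 12 (λ a b c d e f g h i p q r → (a :* (e :* i :- f :* h) :- b :* (d :* i :- f :* g) :+ c :* (d :* h :- e :* g)) :* q
         := (a :* p :+ b :* q :+ c :* r) :* (f :* g :- d :* i) :+ (d :* p :+ e :* q :+ f :* r) :* (i :* a :- g :* c)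
            :+ (g :* p :+ h :* q :+ i :* r) :* (c :* d :- a :* f)) refl
         (x0 r0) (x1 r0) (x2 r0) (x0 r1) (x1 r1) (x2 r1) (x0 r2) (x1 r2) (x2 r2) (x0 w) (x1 w) (x2 w))
      (solve 12 (λ a b c d e f g h i p q r → (a :* (e :* i :- f :* h) :- b :* (d :* i :- f :* g) :+ c :* (d :* h :- e :* g)) :* r
         := (a :* p :+ b :* q :+ c :* r) :* (d :* h :- e :* g) :+ (d :* p :+ e :* q :+ f :* r) :* (g :* b :- h :* a)
            :+ (g :* p :+ h :* q :+ i :* r) :* (a :* e :- b :* d)) refl
         (x0 r0) (x1 r0) (x2 r0) (x0 r1) (x1 r1) (x2 r1) (x0 r2) (x1 r2) (x2 r2) (x0 w) (x1 w) (x2 w))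

  module Kernel (_≟_ : (x y : Carrier) → Dec (x ≡ y)) where

    zero? : (v : Vec3 F) → Zero v ⊎ NonZero v
    zero? v with x0 v ≟ 0# | x1 v ≟ 0# | x2 v ≟ 0#
    ... | yes v0≡0 | yes v1≡0 | yes v2≡0 = inj₁ (fin3-cases v0≡0 v1≡0 v2≡0)
    ... | no v0≢0 | _ | _ = inj₂ (λ v≡0 → v0≢0 (v≡0 i0))
    ... | yes _ | no v1≢0 | _ = inj₂ (λ v≡0 → v1≢0 (v≡0 i1))
    ... | yes _ | yes _ | no v2≢0 = inj₂ (λ v≡0 → v2≢0 (v≡0 i2))

    private
      e0 e1 : Vec3 F
      e0 = vec3 1# 0# 0#
      e1 = vec3 0# 1# 0#

      orthogonal : ∀ a → NonZero a → ∃ λ u → NonZero u × (∀ b → Zero (cross b a) → dot b u ≡ 0#)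
      orthogonal a a≢0 with x1 a ≟ 0# | x2 a ≟ 0#
      ... | yes a1≡0 | yes a2≡0 = cross a e1 , u≢0 , λ b ba≡0 → trans (dot-cross-rotate b a e1) (dot-zeroʳ e1 (cross b a) ba≡0)
        where
        u≢0 : NonZero (cross a e1)
        u≢0 u≡0 = a≢0 (fin3-cases (trans (solve 2 (λ a0 a1 → a0 := a0 :* con 1ℤ :- a1 :* con 0ℤ) refl (x0 a) (x1 a)) (u≡0 i2)) a1≡0 a2≡0)
      ... | no a1≢0 | _ = cross a e0 ,
          (λ u≡0 → a1≢0 (trans (solve 2 (λ a0 a1 → a1 := :- (a0 :* con 0ℤ :- a1 :* con 1ℤ)) refl (x0 a) (x1 a))
                           (trans (cong -_ (u≡0 i2)) -0#≈0#))) ,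
          λ b ba≡0 → trans (dot-cross-rotate b a e0) (dot-zeroʳ e0 (cross b a) ba≡0)
      ... | yes _ | no a2≢0 = cross a e0 ,
          (λ u≡0 → a2≢0 (trans (solve 2 (λ a0 a2 → a2 := a2 :* con 1ℤ :- a0 :* con 0ℤ) refl (x0 a) (x2 a)) (u≡0 i1))) ,
          λ b ba≡0 → trans (dot-cross-rotate b a e0) (dot-zeroʳ e0 (cross b a) ba≡0)

      -- If some cross product of two rows is nonzero it lies in the kernel;
      -- otherwise all rows are parallel.
      kernel : ∀ r0 r1 r2 → det3 r0 r1 r2 ≡ 0# →
               ∃ λ u → NonZero u × dot r0 u ≡ 0# × dot r1 u ≡ 0# × dot r2 u ≡ 0#
      kernel r0 r1 r2 det≡0 with zero? (cross r1 r2) | zero? (cross r2 r0) | zero? (cross r0 r1)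
      ... | inj₂ u≢0 | _ | _ = cross r1 r2 , u≢0 ,
            trans (sym (det3≡dot-cross r0 r1 r2)) det≡0 , dot-cross-self₁ r1 r2 , dot-cross-self₂ r1 r2
      ... | inj₁ _ | inj₂ u≢0 | _ = cross r2 r0 , u≢0 , dot-cross-self₂ r2 r0 ,
            trans (dot-cross-rotate r1 r2 r0) (trans (sym (det3≡dot-cross r0 r1 r2)) det≡0) , dot-cross-self₁ r2 r0
      ... | inj₁ _ | inj₁ _ | inj₂ u≢0 = cross r0 r1 , u≢0 , dot-cross-self₁ r0 r1 , dot-cross-self₂ r0 r1 ,
            trans (sym (dot-cross-rotate r0 r1 r2)) (trans (sym (det3≡dot-cross r0 r1 r2)) det≡0)
      ... | inj₁ r12 | inj₁ r20 | inj₁ r01 with zero? r0 | zero? r1 | zero? r2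
      ...   | inj₂ r0≢0 | _ | _ = let (u , u≢0 , ⊥u) = orthogonal r0 r0≢0 in
              u , u≢0 , ⊥u r0 (cross-self r0) , ⊥u r1 (cross-swap r0 r1 r01) , ⊥u r2 r20
      ...   | inj₁ _ | inj₂ r1≢0 | _ = let (u , u≢0 , ⊥u) = orthogonal r1 r1≢0 in
              u , u≢0 , ⊥u r0 r01 , ⊥u r1 (cross-self r1) , ⊥u r2 (cross-swap r1 r2 r12)
      ...   | inj₁ _ | inj₁ _ | inj₂ r2≢0 = let (u , u≢0 , ⊥u) = orthogonal r2 r2≢0 in
              u , u≢0 , ⊥u r0 (cross-swap r2 r0 r20) , ⊥u r1 r12 , ⊥u r2 (cross-self r2)
      ...   | inj₁ r0≡0 | inj₁ r1≡0 | inj₁ r2≡0 = e0 , (λ e0≡0 → 1≢0 (e0≡0 i0)) ,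
              trans (dot-comm r0 e0) (dot-zeroʳ e0 r0 r0≡0) , trans (dot-comm r1 e0) (dot-zeroʳ e0 r1 r1≡0) ,
              trans (dot-comm r2 e0) (dot-zeroʳ e0 r2 r2≡0)

    detM≡0⇒kernel : ∀ A → detM A ≡ 0# → ∃ λ u → NonZero u × Zero (A · u)
    detM≡0⇒kernel A detA≡0 =
      let (u , u≢0 , r0u , r1u , r2u) = kernel (row A i0) (row A i1) (row A i2) detA≡0 in
      u , u≢0 , fin3-cases r0u r1u r2u

    kernel⇒detM≡0 : ∀ A w → NonZero w → Zero (A · w) → detM A ≡ 0#
    kernel⇒detM≡0 A w w≢0 Aw≡0 with detM A ≟ 0#
    ... | yes detA≡0 = detA≡0
    ... | no detA≢0 = ⊥-elim (w≢0 λ i → x*y≡0⇒y≡0 detA≢0 (trans (adjugate (row A i0) (row A i1) (row A i2) w i)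
          (trans (cong₃ (λ a b c → a * coord (cross (row A i1) (row A i2)) i + b * coord (cross (row A i2) (row A i0)) i
                                     + c * coord (cross (row A i0) (row A i1)) i) (Aw≡0 i0) (Aw≡0 i1) (Aw≡0 i2))
                 (solve 3 (λ a b c → con 0ℤ :* a :+ con 0ℤ :* b :+ con 0ℤ :* c := con 0ℤ) refl _ _ _))))

module TriangleConic (F : Field) (_≟_ : (x y : Field.Carrier F) → Dec (x ≡ y))
  (a b c L1 L2 L3 : Field.Carrier F)
  (a≢0 : a ≢ Field.0# F) (b≢0 : b ≢ Field.0# F) (c≢0 : c ≢ Field.0# F)
  (L1≢0 : L1 ≢ Field.0# F) (L2≢0 : L2 ≢ Field.0# F) (L3≢0 : L3 ≢ Field.0# F)
  (L1≢L2 : L1 ≢ L2) (L2≢L3 : L2 ≢ L3) (L3≢L1 : L3 ≢ L1) where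

  open Field F
  open FieldProperties F
  open Solver
  open Space F
  open ≡-Reasoning

  conic : Vec3 F → Carrier
  conic = triangleForm a b c

  Λ : Vec3 F → Vec3 F
  Λ = diag L1 L2 L3

  private
    d1 = L2 - L3
    d2 = L3 - L1
    d3 = L1 - L2
    Π = L1 * L2 * L3

    d1≢0 : d1 ≢ 0#
    d1≢0 = x≢y⇒x-y≢0 L2≢L3
    d2≢0 : d2 ≢ 0#
    d2≢0 = x≢y⇒x-y≢0 L3≢L1
    d3≢0 : d3 ≢ 0#
    d3≢0 = x≢y⇒x-y≢0 L1≢L2

    Π≢0 : Π ≢ 0#
    Π≢0 = *-nonZero (*-nonZero L1≢0 L2≢0) L3≢0

    x*x≡0⇒x≡0 : ∀ {x} → x * x ≡ 0# → x ≡ 0#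
    x*x≡0⇒x≡0 {x} xx≡0 with x ≟ 0#
    ... | yes x≡0 = x≡0
    ... | no x≢0 = x*y≡0⇒y≡0 x≢0 xx≡0

  -- The conic and its preimage under Λ both pass through the three vertices, so
  -- they meet in exactly one more point.
  fourthPoint : Vec3 F
  fourthPoint = vec3 (a * L2 * L3 * d2 * d3) (b * L1 * L3 * d1 * d3) (c * L1 * L2 * d1 * d2)

  private
    R = fourthPoint

    R0≢0 : x0 R ≢ 0#
    R0≢0 = *-nonZero (*-nonZero (*-nonZero (*-nonZero a≢0 L2≢0) L3≢0) d2≢0) d3≢0

    ΛR0≢0 : x0 (Λ R) ≢ 0#
    ΛR0≢0 = *-nonZero L1≢0 R0≢0

    secant-identity : ∀ P → det3 (Λ R) P (Λ P) ≡ - (Π * d1 * d2 * d3) * conic P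
    secant-identity P = solve 9 (λ a b c L1 L2 L3 x y z → let
        d1 = L2 :- L3 ; d2 = L3 :- L1 ; d3 = L1 :- L2
        u0 = L1 :* (a :* L2 :* L3 :* d2 :* d3) ; u1 = L2 :* (b :* L1 :* L3 :* d1 :* d3) ; u2 = L3 :* (c :* L1 :* L2 :* d1 :* d2)
        w0 = L1 :* x ; w1 = L2 :* y ; w2 = L3 :* z
      in u0 :* (y :* w2 :- z :* w1) :- u1 :* (x :* w2 :- z :* w0) :+ u2 :* (x :* w1 :- y :* w0)
      := :- (L1 :* L2 :* L3 :* d1 :* d2 :* d3) :* (a :* (y :* z) :+ b :* (x :* z) :+ c :* (x :* y)))
      refl a b c L1 L2 L3 (x0 P) (x1 P) (x2 P)

    tangentLine : Vec3 F → Carrier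
    tangentLine X = b * c * (d1 * d1) * x0 X + a * c * (d2 * d2) * x1 X + a * b * (d3 * d3) * x2 X

    tangent-identity : ∀ X → det3 X (Λ R) (Λ (Λ R)) ≡ - (Π * Π * d1 * d2 * d3) * tangentLine X
    tangent-identity X = solve 9 (λ a b c L1 L2 L3 x y z → let
        d1 = L2 :- L3 ; d2 = L3 :- L1 ; d3 = L1 :- L2
        u0 = L1 :* (a :* L2 :* L3 :* d2 :* d3) ; u1 = L2 :* (b :* L1 :* L3 :* d1 :* d3) ; u2 = L3 :* (c :* L1 :* L2 :* d1 :* d2)
        w0 = L1 :* u0 ; w1 = L2 :* u1 ; w2 = L3 :* u2
      in x :* (u1 :* w2 :- u2 :* w1) :- y :* (u0 :* w2 :- u2 :* w0) :+ z :* (u0 :* w1 :- u1 :* w0)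
      := :- (L1 :* L2 :* L3 :* (L1 :* L2 :* L3) :* d1 :* d2 :* d3)
            :* (b :* c :* (d1 :* d1) :* x :+ a :* c :* (d2 :* d2) :* y :+ a :* b :* (d3 :* d3) :* z))
      refl a b c L1 L2 L3 (x0 X) (x1 X) (x2 X)

    -- On the conic, the tangent line at Λ R cuts out a perfect square.
    tangent-square₁ : ∀ X → let S = x0 X * b * d1 - x1 X * a * d2 in
      c * (S * S) ≡ (a * x1 X + b * x0 X) * tangentLine X - d3 * d3 * a * b * conic X
    tangent-square₁ X = solve 9 (λ a b c L1 L2 L3 x y z → let
        d1 = L2 :- L3 ; d2 = L3 :- L1 ; d3 = L1 :- L2
        S = x :* b :* d1 :- y :* a :* d2
      in c :* (S :* S) := (a :* y :+ b :* x) :* (b :* c :* (d1 :* d1) :* x :+ a :* c :* (d2 :* d2) :* y :+ a :* b :* (d3 :* d3) :* z)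
           :- d3 :* d3 :* a :* b :* (a :* (y :* z) :+ b :* (x :* z) :+ c :* (x :* y)))
      refl a b c L1 L2 L3 (x0 X) (x1 X) (x2 X)

    tangent-square₂ : ∀ X → let S = x0 X * c * d1 - x2 X * a * d3 in
      b * (S * S) ≡ (a * x2 X + c * x0 X) * tangentLine X - d2 * d2 * a * c * conic X
    tangent-square₂ X = solve 9 (λ a b c L1 L2 L3 x y z → let
        d1 = L2 :- L3 ; d2 = L3 :- L1 ; d3 = L1 :- L2
        S = x :* c :* d1 :- z :* a :* d3
      in b :* (S :* S) := (a :* z :+ c :* x) :* (b :* c :* (d1 :* d1) :* x :+ a :* c :* (d2 :* d2) :* y :+ a :* b :* (d3 :* d3) :* z)
           :- d2 :* d2 :* a :* c :* (a :* (y :* z) :+ b :* (x :* z) :+ c :* (x :* y)))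
      refl a b c L1 L2 L3 (x0 X) (x1 X) (x2 X)

    minor₁ : ∀ X → x0 X * x1 (Λ R) - x1 X * x0 (Λ R) ≡ Π * d3 * (x0 X * b * d1 - x1 X * a * d2)
    minor₁ X = solve 9 (λ a b c L1 L2 L3 x y z → let
        d1 = L2 :- L3 ; d2 = L3 :- L1 ; d3 = L1 :- L2
      in x :* (L2 :* (b :* L1 :* L3 :* d1 :* d3)) :- y :* (L1 :* (a :* L2 :* L3 :* d2 :* d3))
         := L1 :* L2 :* L3 :* d3 :* (x :* b :* d1 :- y :* a :* d2))
      refl a b c L1 L2 L3 (x0 X) (x1 X) (x2 X)

    minor₂ : ∀ X → x0 X * x2 (Λ R) - x2 X * x0 (Λ R) ≡ Π * d2 * (x0 X * c * d1 - x2 X * a * d3)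
    minor₂ X = solve 9 (λ a b c L1 L2 L3 x y z → let
        d1 = L2 :- L3 ; d2 = L3 :- L1 ; d3 = L1 :- L2
      in x :* (L3 :* (c :* L1 :* L2 :* d1 :* d2)) :- z :* (L1 :* (a :* L2 :* L3 :* d2 :* d3))
         := L1 :* L2 :* L3 :* d2 :* (x :* c :* d1 :- z :* a :* d3))
      refl a b c L1 L2 L3 (x0 X) (x1 X) (x2 X)

    square≡0 : ∀ {k S u v w e} → k ≢ 0# → k * (S * S) ≡ u * v - w * e → v ≡ 0# → e ≡ 0# → S ≡ 0#
    square≡0 {k} {S} {u} {v} {w} {e} k≢0 eq v≡0 e≡0 = x*x≡0⇒x≡0 (x*y≡0⇒y≡0 k≢0 (begin
      k * (S * S)       ≡⟨ eq ⟩
      u * v - w * e     ≡⟨ cong₂ (λ p q → u * p - w * q) v≡0 e≡0 ⟩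
      u * 0# - w * 0#   ≡⟨ solve 2 (λ u w → u :* con 0ℤ :- w :* con 0ℤ := con 0ℤ) refl u w ⟩
      0#                ∎))

    minor≡0 : ∀ {X Y k S} → X - Y ≡ k * S → S ≡ 0# → X ≡ Y
    minor≡0 {k = k} eq S≡0 = x-y≡0⇒x≡y (trans eq (trans (cong (k *_) S≡0) (zeroʳ k)))

    tangent-at-ΛR : ∀ X → conic X ≡ 0# → det3 X (Λ R) (Λ (Λ R)) ≡ 0# → X ≐ scale (x0 X * x0 (Λ R) ⁻¹⟨ ΛR0≢0 ⟩) (Λ R)
    tangent-at-ΛR X X∈conic X∈line = proportional-by-minors X (Λ R) ΛR0≢0
      (minor≡0 (minor₁ X) (square≡0 c≢0 (tangent-square₁ X) line≡0 X∈conic))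
      (minor≡0 (minor₂ X) (square≡0 b≢0 (tangent-square₂ X) line≡0 X∈conic))
      where
      line≡0 : tangentLine X ≡ 0#
      line≡0 = x*y≡0⇒y≡0 (-‿nonZero (*-nonZero (*-nonZero (*-nonZero (*-nonZero Π≢0 Π≢0) d1≢0) d2≢0) d3≢0))
                 (trans (sym (tangent-identity X)) X∈line)

  module _ (P0 : Vec3 F) (P0₀≢0 : x0 P0 ≢ 0#) (P0₁≢0 : x1 P0 ≢ 0#) (P0₂≢0 : x2 P0 ≢ 0#)
           (P0∈conic : conic P0 ≡ 0#) (ΛP0∈conic : conic (Λ P0) ≡ 0#) where

    private
      x = x0 P0
      y = x1 P0
      z = x2 P0
      κ = a * b * c * Π * d1 * d2 * d3 * (x * y * z)

      κ≢0 : κ ≢ 0#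
      κ≢0 = *-nonZero (*-nonZero (*-nonZero (*-nonZero (*-nonZero (*-nonZero (*-nonZero a≢0 b≢0) c≢0) Π≢0) d1≢0) d2≢0) d3≢0)
              (*-nonZero (*-nonZero P0₀≢0 P0₁≢0) P0₂≢0)

      ΛP0∈conic′ : a * L2 * L3 * (y * z) + b * L1 * L3 * (x * z) + c * L1 * L2 * (x * y) ≡ 0#
      ΛP0∈conic′ = trans (solve 9 (λ a b c L1 L2 L3 x y z →
          a :* L2 :* L3 :* (y :* z) :+ b :* L1 :* L3 :* (x :* z) :+ c :* L1 :* L2 :* (x :* y)
          := a :* ((L2 :* y) :* (L3 :* z)) :+ b :* ((L1 :* x) :* (L3 :* z)) :+ c :* ((L1 :* x) :* (L2 :* y)))
          refl a b c L1 L2 L3 x y z) ΛP0∈conic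

      -- eliminating one product of coordinates between the two conic equations
      elimination₁ : κ * (x * x1 R - y * x0 R) ≡
        (conic P0 * (c * L1 * L2) - (a * L2 * L3 * (y * z) + b * L1 * L3 * (x * z) + c * L1 * L2 * (x * y)) * c)
          * (x0 R * x1 R * x * y)
      elimination₁ = solve 9 (λ a b c L1 L2 L3 x y z → let
          d1 = L2 :- L3 ; d2 = L3 :- L1 ; d3 = L1 :- L2
          R0 = a :* L2 :* L3 :* d2 :* d3 ; R1 = b :* L1 :* L3 :* d1 :* d3
        in a :* b :* c :* (L1 :* L2 :* L3) :* d1 :* d2 :* d3 :* (x :* y :* z) :* (x :* R1 :- y :* R0)
        := ((a :* (y :* z) :+ b :* (x :* z) :+ c :* (x :* y)) :* (c :* L1 :* L2)
             :- (a :* L2 :* L3 :* (y :* z) :+ b :* L1 :* L3 :* (x :* z) :+ c :* L1 :* L2 :* (x :* y)) :* c) :* (R0 :* R1 :* x :* y))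
        refl a b c L1 L2 L3 x y z

      elimination₂ : κ * (x * x2 R - z * x0 R) ≡
        ((a * L2 * L3 * (y * z) + b * L1 * L3 * (x * z) + c * L1 * L2 * (x * y)) * b - conic P0 * (b * L1 * L3))
          * (x0 R * x2 R * x * z)
      elimination₂ = solve 9 (λ a b c L1 L2 L3 x y z → let
          d1 = L2 :- L3 ; d2 = L3 :- L1 ; d3 = L1 :- L2
          R0 = a :* L2 :* L3 :* d2 :* d3 ; R2 = c :* L1 :* L2 :* d1 :* d2
        in a :* b :* c :* (L1 :* L2 :* L3) :* d1 :* d2 :* d3 :* (x :* y :* z) :* (x :* R2 :- z :* R0)
        := ((a :* L2 :* L3 :* (y :* z) :+ b :* L1 :* L3 :* (x :* z) :+ c :* L1 :* L2 :* (x :* y)) :* b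
             :- (a :* (y :* z) :+ b :* (x :* z) :+ c :* (x :* y)) :* (b :* L1 :* L3)) :* (R0 :* R2 :* x :* z))
        refl a b c L1 L2 L3 x y z

      vanishes : ∀ {d} u v w r s → κ * d ≡ (u * v - w * r) * s → u ≡ 0# → w ≡ 0# → d ≡ 0#
      vanishes {d} u v w r s eq u≡0 w≡0 = x*y≡0⇒y≡0 κ≢0 (trans eq (trans (cong₂ (λ p q → (p * v - q * r) * s) u≡0 w≡0)
        (solve 3 (λ v r s → (con 0ℤ :* v :- con 0ℤ :* r) :* s := con 0ℤ) refl v r s)))

      θ = x * x0 R ⁻¹⟨ R0≢0 ⟩

    P0≐θR : P0 ≐ scale θ R
    P0≐θR = proportional-by-minors P0 R R0≢0
      (x-y≡0⇒x≡y (vanishes _ _ _ _ _ elimination₁ P0∈conic ΛP0∈conic′))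
      (x-y≡0⇒x≡y (vanishes _ _ _ _ _ elimination₂ ΛP0∈conic′ P0∈conic))

    θ≢0 : θ ≢ 0#
    θ≢0 θ≡0 = P0₀≢0 (trans (at P0≐θR i0) (trans (cong (_* x0 R) θ≡0) (zeroˡ _)))

    private
      ΛP0≐θΛR : Λ P0 ≐ scale θ (Λ R)
      ΛP0≐θΛR = ≐-trans (diag-cong L1 L2 L3 P0≐θR) (diag-scale L1 L2 L3 θ R)

    secant-through-ΛP0 : ∀ P → conic P ≡ 0# → det3 (Λ P0) P (Λ P) ≡ 0#
    secant-through-ΛP0 P P∈conic = begin
      det3 (Λ P0) P (Λ P)                      ≡⟨ det3-cong ΛP0≐θΛR (≐-refl {P}) (≐-refl {Λ P}) ⟩
      det3 (scale θ (Λ R)) P (Λ P)             ≡⟨ det3-scale₁ θ (Λ R) P (Λ P) ⟩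
      θ * det3 (Λ R) P (Λ P)                   ≡⟨ cong (θ *_) (secant-identity P) ⟩
      θ * (- (Π * d1 * d2 * d3) * conic P)     ≡⟨ cong (λ t → θ * (- (Π * d1 * d2 * d3) * t)) P∈conic ⟩
      θ * (- (Π * d1 * d2 * d3) * 0#)          ≡⟨ solve 2 (λ θ k → θ :* (:- k :* con 0ℤ) := con 0ℤ) refl θ (Π * d1 * d2 * d3) ⟩
      0#                                       ∎

    tangent-at-ΛP0 : ∀ X → conic X ≡ 0# → det3 X (Λ P0) (Λ (Λ P0)) ≡ 0# → ∃ λ t → X ≐ scale t (Λ P0)
    tangent-at-ΛP0 X X∈conic X∈line = _ , rescale θ≢0 ΛP0≐θΛR (tangent-at-ΛR X X∈conic X∈line′)
      where
      Λ²P0≐θΛ²R : Λ (Λ P0) ≐ scale θ (Λ (Λ R))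
      Λ²P0≐θΛ²R = ≐-trans (diag-cong L1 L2 L3 ΛP0≐θΛR) (diag-scale L1 L2 L3 θ (Λ R))

      X∈line′ : det3 X (Λ R) (Λ (Λ R)) ≡ 0#
      X∈line′ = x*y≡0⇒y≡0 (*-nonZero θ≢0 θ≢0) (begin
        θ * θ * det3 X (Λ R) (Λ (Λ R))                   ≡⟨ *-assoc θ θ _ ⟩
        θ * (θ * det3 X (Λ R) (Λ (Λ R)))                 ≡⟨ cong (θ *_) (det3-scale₃ θ X (Λ R) (Λ (Λ R))) ⟨
        θ * det3 X (Λ R) (scale θ (Λ (Λ R)))             ≡⟨ det3-scale₂ θ X (Λ R) (scale θ (Λ (Λ R))) ⟨
        det3 X (scale θ (Λ R)) (scale θ (Λ (Λ R)))       ≡⟨ det3-cong (≐-refl {X}) ΛP0≐θΛR Λ²P0≐θΛ²R ⟨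
        det3 X (Λ P0) (Λ (Λ P0))                         ≡⟨ X∈line ⟩
        0#                                               ∎)

module Eigenbasis (F : Field) (_≟_ : (x y : Field.Carrier F) → Dec (x ≡ y)) (M : Mat3 F)
  (w1 w2 w3 : Vec3 F) (l1 l2 l3 : Field.Carrier F)
  (w1≢0 : NonZero w1) (w2≢0 : NonZero w2) (w3≢0 : NonZero w3)
  (eigen₁ : ∀ i → coord (M · w1) i ≡ Field._*_ F l1 (coord w1 i))
  (eigen₂ : ∀ i → coord (M · w2) i ≡ Field._*_ F l2 (coord w2 i))
  (eigen₃ : ∀ i → coord (M · w3) i ≡ Field._*_ F l3 (coord w3 i))
  (l1≢0 : l1 ≢ Field.0# F) (l2≢0 : l2 ≢ Field.0# F) (l3≢0 : l3 ≢ Field.0# F)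
  (l1≢l2 : l1 ≢ l2) (l2≢l3 : l2 ≢ l3) (l3≢l1 : l3 ≢ l1) where

  open Field F
  open FieldProperties F
  open Solver
  open Space F
  open Kernel _≟_
  open ≡-Reasoning

  private
    Mw1 : M · w1 ≐ scale l1 w1
    Mw1 = coordwise eigen₁
    Mw2 : M · w2 ≐ scale l2 w2
    Mw2 = coordwise eigen₂
    Mw3 : M · w3 ≐ scale l3 w3
    Mw3 = coordwise eigen₃

  basis : Fin 3 → Vec3 F
  basis = fin3-cases {P = λ _ → Vec3 F} w1 w2 w3

  basisMatrix : Mat3 F
  basisMatrix = mat (λ i j → coord (basis j) i)

  D : Carrier
  D = det3 w1 w2 w3

  detM-basisMatrix : detM basisMatrix ≡ D
  detM-basisMatrix = det3-transpose w1 w2 w3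

  coordinates : Vec3 F → Vec3 F
  coordinates X = vec3 (det3 X w2 w3) (det3 w1 X w3) (det3 w1 w2 X)

  private
    Relation : Vec3 F → Set
    Relation c = Zero (basisMatrix · c)

    multiply-by-eigenvalues : ∀ {α β γ} → Relation (vec3 α β γ) → Relation (vec3 (α * l1) (β * l2) (γ * l3))
    multiply-by-eigenvalues {α} {β} {γ} rel i = begin
      coord w1 i * (α * l1) + coord w2 i * (β * l2) + coord w3 i * (γ * l3)
        ≡⟨ solve 9 (λ a b c l1 l2 l3 x y z → x :* (a :* l1) :+ y :* (b :* l2) :+ z :* (c :* l3)
                      := a :* (l1 :* x) :+ b :* (l2 :* y) :+ c :* (l3 :* z)) refl
             α β γ l1 l2 l3 (coord w1 i) (coord w2 i) (coord w3 i) ⟩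
      α * (l1 * coord w1 i) + β * (l2 * coord w2 i) + γ * (l3 * coord w3 i)
        ≡⟨ cong₃ (λ p q r → α * p + β * q + γ * r) (sym (eigen₁ i)) (sym (eigen₂ i)) (sym (eigen₃ i)) ⟩
      α * coord (M · w1) i + β * coord (M · w2) i + γ * coord (M · w3) i
        ≡⟨ solve 15 (λ a b c m0 m1 m2 p0 p1 p2 q0 q1 q2 r0 r1 r2 →
             a :* (m0 :* p0 :+ m1 :* p1 :+ m2 :* p2) :+ b :* (m0 :* q0 :+ m1 :* q1 :+ m2 :* q2) :+ c :* (m0 :* r0 :+ m1 :* r1 :+ m2 :* r2)
             := m0 :* (p0 :* a :+ q0 :* b :+ r0 :* c) :+ m1 :* (p1 :* a :+ q1 :* b :+ r1 :* c) :+ m2 :* (p2 :* a :+ q2 :* b :+ r2 :* c)) refl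
             α β γ (entry M i i0) (entry M i i1) (entry M i i2)
             (x0 w1) (x1 w1) (x2 w1) (x0 w2) (x1 w2) (x2 w2) (x0 w3) (x1 w3) (x2 w3) ⟩
      coord (M · (basisMatrix · vec3 α β γ)) i
        ≡⟨ at (·-cong M (coordwise rel)) i ⟩
      coord (M · zeroVec) i
        ≡⟨ at (·-zeroVec M) i ⟩
      0# ∎

    factor≡0 : ∀ {s} v → NonZero {F} v → (∀ i → s * coord v i ≡ 0#) → s ≡ 0#
    factor≡0 {s} v v≢0 sv≡0 with s ≟ 0#
    ... | yes s≡0 = s≡0
    ... | no s≢0 = ⊥-elim (v≢0 (λ i → x*y≡0⇒y≡0 s≢0 (sv≡0 i)))

    combine≡0 : ∀ {p q r} s t → p ≡ 0# → q ≡ 0# → r ≡ 0# → (p - s * q) + t * r ≡ 0#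
    combine≡0 s t refl refl refl = solve 2 (λ s t → (con 0ℤ :- s :* con 0ℤ) :+ t :* con 0ℤ := con 0ℤ) refl s t

    -- Lagrange interpolation at the nodes l1 l2 l3: the combination
    -- R₂ − (lj + lk) R₁ + lj lk R₀ of the relations R₀, R₁, R₂ keeps only the i-th term.
    interpolation₁ : ∀ a b c x y z →
      a * ((l1 - l2) * (l1 - l3)) * x ≡
      ((x * (a * l1 * l1) + y * (b * l2 * l2) + z * (c * l3 * l3))
        - (l2 + l3) * (x * (a * l1) + y * (b * l2) + z * (c * l3)))
      + l2 * l3 * (x * a + y * b + z * c)
    interpolation₁ a b c x y z = solve 9 (λ a b c l1 l2 l3 x y z →
        a :* ((l1 :- l2) :* (l1 :- l3)) :* x
        := (x :* (a :* l1 :* l1) :+ y :* (b :* l2 :* l2) :+ z :* (c :* l3 :* l3)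
             :- (l2 :+ l3) :* (x :* (a :* l1) :+ y :* (b :* l2) :+ z :* (c :* l3)))
           :+ l2 :* l3 :* (x :* a :+ y :* b :+ z :* c)) refl a b c l1 l2 l3 x y z

    interpolation₂ : ∀ a b c x y z →
      b * ((l2 - l1) * (l2 - l3)) * y ≡
      ((x * (a * l1 * l1) + y * (b * l2 * l2) + z * (c * l3 * l3))
        - (l1 + l3) * (x * (a * l1) + y * (b * l2) + z * (c * l3)))
      + l1 * l3 * (x * a + y * b + z * c)
    interpolation₂ a b c x y z = solve 9 (λ a b c l1 l2 l3 x y z →
        b :* ((l2 :- l1) :* (l2 :- l3)) :* y
        := (x :* (a :* l1 :* l1) :+ y :* (b :* l2 :* l2) :+ z :* (c :* l3 :* l3)
             :- (l1 :+ l3) :* (x :* (a :* l1) :+ y :* (b :* l2) :+ z :* (c :* l3)))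
           :+ l1 :* l3 :* (x :* a :+ y :* b :+ z :* c)) refl a b c l1 l2 l3 x y z

    interpolation₃ : ∀ a b c x y z →
      c * ((l3 - l1) * (l3 - l2)) * z ≡
      ((x * (a * l1 * l1) + y * (b * l2 * l2) + z * (c * l3 * l3))
        - (l1 + l2) * (x * (a * l1) + y * (b * l2) + z * (c * l3)))
      + l1 * l2 * (x * a + y * b + z * c)
    interpolation₃ a b c x y z = solve 9 (λ a b c l1 l2 l3 x y z →
        c :* ((l3 :- l1) :* (l3 :- l2)) :* z
        := (x :* (a :* l1 :* l1) :+ y :* (b :* l2 :* l2) :+ z :* (c :* l3 :* l3)
             :- (l1 :+ l2) :* (x :* (a :* l1) :+ y :* (b :* l2) :+ z :* (c :* l3)))
           :+ l1 :* l2 :* (x :* a :+ y :* b :+ z :* c)) refl a b c l1 l2 l3 x y z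

  eigenvectors-independent : ∀ c → Zero (basisMatrix · c) → Zero c
  eigenvectors-independent c rel₀ = fin3-cases α≡0 β≡0 γ≡0
    where
    α = x0 c
    β = x1 c
    γ = x2 c

    rel₁ : Relation (vec3 (α * l1) (β * l2) (γ * l3))
    rel₁ = multiply-by-eigenvalues {α} {β} {γ} rel₀

    rel₂ : Relation (vec3 (α * l1 * l1) (β * l2 * l2) (γ * l3 * l3))
    rel₂ = multiply-by-eigenvalues rel₁

    α≡0 : α ≡ 0#
    α≡0 = x*y≡0⇒x≡0 (*-nonZero (x≢y⇒x-y≢0 l1≢l2) (x≢y⇒x-y≢0 (λ eq → l3≢l1 (sym eq))))
      (factor≡0 w1 w1≢0 λ i → trans (interpolation₁ α β γ (coord w1 i) (coord w2 i) (coord w3 i))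
        (combine≡0 (l2 + l3) (l2 * l3) (rel₂ i) (rel₁ i) (rel₀ i)))

    β≡0 : β ≡ 0#
    β≡0 = x*y≡0⇒x≡0 (*-nonZero (x≢y⇒x-y≢0 (λ eq → l1≢l2 (sym eq))) (x≢y⇒x-y≢0 l2≢l3))
      (factor≡0 w2 w2≢0 λ i → trans (interpolation₂ α β γ (coord w1 i) (coord w2 i) (coord w3 i))
        (combine≡0 (l1 + l3) (l1 * l3) (rel₂ i) (rel₁ i) (rel₀ i)))

    γ≡0 : γ ≡ 0#
    γ≡0 = x*y≡0⇒x≡0 (*-nonZero (x≢y⇒x-y≢0 l3≢l1) (x≢y⇒x-y≢0 (λ eq → l2≢l3 (sym eq))))
      (factor≡0 w3 w3≢0 λ i → trans (interpolation₃ α β γ (coord w1 i) (coord w2 i) (coord w3 i))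
        (combine≡0 (l1 + l2) (l1 * l2) (rel₂ i) (rel₁ i) (rel₀ i)))

  D≢0 : D ≢ 0#
  D≢0 D≡0 = let (c , c≢0 , rel) = detM≡0⇒kernel basisMatrix (trans detM-basisMatrix D≡0) in c≢0 (eigenvectors-independent c rel)

  cramer : ∀ X → scale D X ≐ basisMatrix · coordinates X
  cramer X = coordwise (fin3-cases
    (solve 12 (λ x y z a0 a1 a2 b0 b1 b2 c0 c1 c2 → let
        dt : _ → _ → _ → _ → _ → _ → _ → _ → _ → _
        dt a b c d e f g h i = a :* (e :* i :- f :* h) :- b :* (d :* i :- f :* g) :+ c :* (d :* h :- e :* g)
      in dt a0 a1 a2 b0 b1 b2 c0 c1 c2 :* x := a0 :* dt x y z b0 b1 b2 c0 c1 c2 :+ b0 :* dt a0 a1 a2 x y z c0 c1 c2 :+ c0 :* dt a0 a1 a2 b0 b1 b2 x y z) refl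
      (x0 X) (x1 X) (x2 X) (x0 w1) (x1 w1) (x2 w1) (x0 w2) (x1 w2) (x2 w2) (x0 w3) (x1 w3) (x2 w3))
    (solve 12 (λ x y z a0 a1 a2 b0 b1 b2 c0 c1 c2 → let
        dt : _ → _ → _ → _ → _ → _ → _ → _ → _ → _
        dt a b c d e f g h i = a :* (e :* i :- f :* h) :- b :* (d :* i :- f :* g) :+ c :* (d :* h :- e :* g)
      in dt a0 a1 a2 b0 b1 b2 c0 c1 c2 :* y := a1 :* dt x y z b0 b1 b2 c0 c1 c2 :+ b1 :* dt a0 a1 a2 x y z c0 c1 c2 :+ c1 :* dt a0 a1 a2 b0 b1 b2 x y z) refl
      (x0 X) (x1 X) (x2 X) (x0 w1) (x1 w1) (x2 w1) (x0 w2) (x1 w2) (x2 w2) (x0 w3) (x1 w3) (x2 w3))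
    (solve 12 (λ x y z a0 a1 a2 b0 b1 b2 c0 c1 c2 → let
        dt : _ → _ → _ → _ → _ → _ → _ → _ → _ → _
        dt a b c d e f g h i = a :* (e :* i :- f :* h) :- b :* (d :* i :- f :* g) :+ c :* (d :* h :- e :* g)
      in dt a0 a1 a2 b0 b1 b2 c0 c1 c2 :* z := a2 :* dt x y z b0 b1 b2 c0 c1 c2 :+ b2 :* dt a0 a1 a2 x y z c0 c1 c2 :+ c2 :* dt a0 a1 a2 b0 b1 b2 x y z) refl
      (x0 X) (x1 X) (x2 X) (x0 w1) (x1 w1) (x2 w1) (x0 w2) (x1 w2) (x2 w2) (x0 w3) (x1 w3) (x2 w3)))

  coordinates-cong : ∀ {X Y} → X ≐ Y → coordinates X ≐ coordinates Y
  coordinates-cong X≐Y = coordwise λ i → cong (λ Z → coord (coordinates Z) i) (≐⇒normal≡ X≐Y)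

  coordinates-scale : ∀ s X → coordinates (scale s X) ≐ scale s (coordinates X)
  coordinates-scale s X = coordwise (fin3-cases (det3-scale₁ s X w2 w3) (det3-scale₂ s w1 X w3) (det3-scale₃ s w1 w2 X))

  coordinates-injective : ∀ {X Y} → coordinates X ≐ coordinates Y → X ≐ Y
  coordinates-injective {X} {Y} cX≐cY = coordwise λ i → *-cancelˡ D≢0 (begin
    D * coord X i                            ≡⟨ at (cramer X) i ⟩
    coord (basisMatrix · coordinates X) i    ≡⟨ at (·-cong basisMatrix cX≐cY) i ⟩
    coord (basisMatrix · coordinates Y) i    ≡⟨ at (cramer Y) i ⟨
    D * coord Y i                            ∎)

  coordinates-zero : ∀ X → Zero (coordinates X) → Zero X
  coordinates-zero X cX≡0 i = x*y≡0⇒y≡0 D≢0 (begin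
    D * coord X i                            ≡⟨ at (cramer X) i ⟩
    coord (basisMatrix · coordinates X) i    ≡⟨ at (·-cong basisMatrix (coordwise cX≡0)) i ⟩
    coord (basisMatrix · zeroVec) i          ≡⟨ at (·-zeroVec basisMatrix) i ⟩
    0#                                       ∎)

  det3-coordinates : ∀ X Y Z → det3 (coordinates X) (coordinates Y) (coordinates Z) ≡ D * D * det3 X Y Z
  det3-coordinates X Y Z = *-cancelʳ D≢0 (begin
    det3 (coordinates X) (coordinates Y) (coordinates Z) * D
      ≡⟨ trans (*-comm _ D) (cong (_* det3 (coordinates X) (coordinates Y) (coordinates Z)) (sym detM-basisMatrix)) ⟩
    detM basisMatrix * det3 (coordinates X) (coordinates Y) (coordinates Z)
      ≡⟨ det3-· basisMatrix (coordinates X) (coordinates Y) (coordinates Z) ⟨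
    det3 (basisMatrix · coordinates X) (basisMatrix · coordinates Y) (basisMatrix · coordinates Z)
      ≡⟨ det3-cong (cramer X) (cramer Y) (cramer Z) ⟨
    det3 (scale D X) (scale D Y) (scale D Z)
      ≡⟨ det3-scale₁ D X (scale D Y) (scale D Z) ⟩
    D * det3 X (scale D Y) (scale D Z)
      ≡⟨ cong (D *_) (trans (det3-scale₂ D X Y (scale D Z)) (cong (D *_) (det3-scale₃ D X Y Z))) ⟩
    D * (D * (D * det3 X Y Z))
      ≡⟨ solve 2 (λ d x → d :* (d :* (d :* x)) := d :* d :* x :* d) refl D (det3 X Y Z) ⟩
    D * D * det3 X Y Z * D ∎)

  private
    detM-M : detM M ≡ l1 * l2 * l3
    detM-M = *-cancelʳ D≢0 (begin
      detM M * D                                     ≡⟨ det3-· M w1 w2 w3 ⟨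
      det3 (M · w1) (M · w2) (M · w3)                ≡⟨ det3-cong Mw1 Mw2 Mw3 ⟩
      det3 (scale l1 w1) (scale l2 w2) (scale l3 w3) ≡⟨ det3-scale₁ l1 w1 (scale l2 w2) (scale l3 w3) ⟩
      l1 * det3 w1 (scale l2 w2) (scale l3 w3)       ≡⟨ cong (l1 *_) (trans (det3-scale₂ l2 w1 w2 (scale l3 w3)) (cong (l2 *_) (det3-scale₃ l3 w1 w2 w3))) ⟩
      l1 * (l2 * (l3 * D))                           ≡⟨ solve 4 (λ a b c d → a :* (b :* (c :* d)) := a :* b :* c :* d) refl l1 l2 l3 D ⟩
      l1 * l2 * l3 * D                               ∎)

    det3-M-eigen : ∀ {u v lu lv} X → M · u ≐ scale lu u → M · v ≐ scale lv v →
      lu * lv * det3 (M · X) u v ≡ l1 * l2 * l3 * det3 X u v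
    det3-M-eigen {u} {v} {lu} {lv} X Mu Mv = begin
      lu * lv * det3 (M · X) u v                   ≡⟨ *-assoc lu lv _ ⟩
      lu * (lv * det3 (M · X) u v)                 ≡⟨ cong (lu *_) (det3-scale₃ lv (M · X) u v) ⟨
      lu * det3 (M · X) u (scale lv v)             ≡⟨ det3-scale₂ lu (M · X) u (scale lv v) ⟨
      det3 (M · X) (scale lu u) (scale lv v)       ≡⟨ det3-cong (≐-refl {M · X}) Mu Mv ⟨
      det3 (M · X) (M · u) (M · v)                 ≡⟨ det3-· M X u v ⟩
      detM M * det3 X u v                          ≡⟨ cong (_* det3 X u v) detM-M ⟩
      l1 * l2 * l3 * det3 X u v                    ∎

  coordinates-· : ∀ X → coordinates (M · X) ≐ diag l1 l2 l3 (coordinates X)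
  coordinates-· X = coordwise (fin3-cases
    (*-cancelˡ (*-nonZero l2≢0 l3≢0) (trans (det3-M-eigen X Mw2 Mw3)
      (solve 4 (λ a b c d → a :* b :* c :* d := b :* c :* (a :* d)) refl l1 l2 l3 _)))
    (*-cancelˡ (*-nonZero l3≢0 l1≢0) (begin
      l3 * l1 * det3 w1 (M · X) w3       ≡⟨ cong (l3 * l1 *_) (rotate² w1 (M · X) w3) ⟩
      l3 * l1 * det3 (M · X) w3 w1       ≡⟨ det3-M-eigen X Mw3 Mw1 ⟩
      l1 * l2 * l3 * det3 X w3 w1        ≡⟨ cong (l1 * l2 * l3 *_) (rotate² w1 X w3) ⟨
      l1 * l2 * l3 * det3 w1 X w3        ≡⟨ solve 4 (λ a b c d → a :* b :* c :* d := c :* a :* (b :* d)) refl l1 l2 l3 _ ⟩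
      l3 * l1 * (l2 * det3 w1 X w3)      ∎))
    (*-cancelˡ (*-nonZero l1≢0 l2≢0) (begin
      l1 * l2 * det3 w1 w2 (M · X)       ≡⟨ cong (l1 * l2 *_) (det3-rotate w1 w2 (M · X)) ⟩
      l1 * l2 * det3 (M · X) w1 w2       ≡⟨ det3-M-eigen X Mw1 Mw2 ⟩
      l1 * l2 * l3 * det3 X w1 w2        ≡⟨ cong (l1 * l2 * l3 *_) (det3-rotate w1 w2 X) ⟨
      l1 * l2 * l3 * det3 w1 w2 X        ≡⟨ *-assoc (l1 * l2) l3 _ ⟩
      l1 * l2 * (l3 * det3 w1 w2 X)      ∎)))
    where
    rotate² : ∀ u v w → det3 u v w ≡ det3 v w u
    rotate² u v w = trans (det3-rotate u v w) (det3-rotate w u v)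

  coordinates-^ : ∀ e X → coordinates ((M ^ᴹ e) · X) ≐ diag (l1 ^ e) (l2 ^ e) (l3 ^ e) (coordinates X)
  coordinates-^ zero X = ≐-trans (coordinates-cong (I3-· X))
    (coordwise (fin3-cases (sym (*-identityˡ _)) (sym (*-identityˡ _)) (sym (*-identityˡ _))))
  coordinates-^ (suc e) X = ≐-trans (coordinates-cong (⊗-· M (M ^ᴹ e) X))
    (≐-trans (coordinates-· ((M ^ᴹ e) · X)) (coordwise (fin3-cases
      (trans (cong (l1 *_) (at (coordinates-^ e X) i0)) (sym (*-assoc _ _ _)))
      (trans (cong (l2 *_) (at (coordinates-^ e X) i1)) (sym (*-assoc _ _ _)))
      (trans (cong (l3 *_) (at (coordinates-^ e X) i2)) (sym (*-assoc _ _ _))))))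

  private
    eval-combination : ∀ G c → eval G (basisMatrix · c) ≡
      x0 c * x0 c * eval G w1 + x1 c * x1 c * eval G w2 + x2 c * x2 c * eval G w3
      + x1 c * x2 c * polar G w2 w3 + x0 c * x2 c * polar G w1 w3 + x0 c * x1 c * polar G w1 w2
    eval-combination G@(qform ga gb gc gd ge gf) c = solve 18 (λ a b cc d e f c0 c1 c2 p0 p1 p2 q0 q1 q2 r0 r1 r2 → let
        ev : _ → _ → _ → _
        ev x y z = a :* x :* x :+ b :* y :* y :+ cc :* z :* z :+ d :* x :* y :+ e :* x :* z :+ f :* y :* z
      in ev (p0 :* c0 :+ q0 :* c1 :+ r0 :* c2) (p1 :* c0 :+ q1 :* c1 :+ r1 :* c2) (p2 :* c0 :+ q2 :* c1 :+ r2 :* c2)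
         := c0 :* c0 :* ev p0 p1 p2 :+ c1 :* c1 :* ev q0 q1 q2 :+ c2 :* c2 :* ev r0 r1 r2
           :+ c1 :* c2 :* (ev (q0 :+ r0) (q1 :+ r1) (q2 :+ r2) :- ev q0 q1 q2 :- ev r0 r1 r2)
           :+ c0 :* c2 :* (ev (p0 :+ r0) (p1 :+ r1) (p2 :+ r2) :- ev p0 p1 p2 :- ev r0 r1 r2)
           :+ c0 :* c1 :* (ev (p0 :+ q0) (p1 :+ q1) (p2 :+ q2) :- ev p0 p1 p2 :- ev q0 q1 q2)) refl
      ga gb gc gd ge gf (x0 c) (x1 c) (x2 c) (x0 w1) (x1 w1) (x2 w1) (x0 w2) (x1 w2) (x2 w2) (x0 w3) (x1 w3) (x2 w3)

  eval-coordinates : ∀ G → eval G w1 ≡ 0# → eval G w2 ≡ 0# → eval G w3 ≡ 0# → ∀ X →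
    D * D * eval G X ≡ triangleForm (polar G w2 w3) (polar G w1 w3) (polar G w1 w2) (coordinates X)
  eval-coordinates G Gw1≡0 Gw2≡0 Gw3≡0 X = begin
    D * D * eval G X                         ≡⟨ eval-scale G D X ⟨
    eval G (scale D X)                       ≡⟨ eval-cong G (cramer X) ⟩
    eval G (basisMatrix · c)                 ≡⟨ eval-combination G c ⟩
    x0 c * x0 c * eval G w1 + x1 c * x1 c * eval G w2 + x2 c * x2 c * eval G w3
      + x1 c * x2 c * pa + x0 c * x2 c * pb + x0 c * x1 c * pc
                                             ≡⟨ cong₃ (λ u v w → x0 c * x0 c * u + x1 c * x1 c * v + x2 c * x2 c * w
                                                  + x1 c * x2 c * pa + x0 c * x2 c * pb + x0 c * x1 c * pc) Gw1≡0 Gw2≡0 Gw3≡0 ⟩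
    x0 c * x0 c * 0# + x1 c * x1 c * 0# + x2 c * x2 c * 0#
      + x1 c * x2 c * pa + x0 c * x2 c * pb + x0 c * x1 c * pc
                                             ≡⟨ solve 6 (λ x y z a b c → x :* x :* con 0ℤ :+ y :* y :* con 0ℤ :+ z :* z :* con 0ℤ
                                                  :+ y :* z :* a :+ x :* z :* b :+ x :* y :* c
                                                  := a :* (y :* z) :+ b :* (x :* z) :+ c :* (x :* y)) refl
                                                  (x0 c) (x1 c) (x2 c) pa pb pc ⟩
    triangleForm pa pb pc c                  ∎
    where
    c = coordinates X
    pa = polar G w2 w3
    pb = polar G w1 w3
    pc = polar G w1 w2

module Embedding {F K : Field} (ι : FieldEmbedding F K)
  (_≟F_ : (x y : Field.Carrier F) → Dec (x ≡ y)) where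

  private
    module F = Field F
    module FP = FieldProperties F
    module FS = Space F
  open Field K
  open FieldProperties K
  open Space K
  open FieldEmbedding ι
  open ≡-Reasoning

  map-0 : map F.0# ≡ 0#
  map-0 = +-cancelˡ (trans (sym (map-+ F.0# F.0#)) (trans (cong map (FP.+-identityʳ F.0#)) (sym (+-identityʳ _))))

  map-neg : ∀ x → map (F.- x) ≡ - map x
  map-neg x = inverseʳ-unique (map x) (map (F.- x))
    (trans (sym (map-+ x (F.- x))) (trans (cong map (FP.-‿inverseʳ x)) map-0))

  map-sub : ∀ x y → map (x F.- y) ≡ map x - map y
  map-sub x y = trans (map-+ x (F.- y)) (cong (map x +_) (map-neg y))

  map-nonZero : ∀ {x} → x ≢ F.0# → map x ≢ 0#
  map-nonZero {x} x≢0 mx≡0 = 1≢0 (begin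
    1#                                 ≡⟨ map-1 ⟨
    map F.1#                           ≡⟨ cong map (FP.inverseʳ x x≢0) ⟨
    map (x F.* x FP.⁻¹⟨ x≢0 ⟩)          ≡⟨ map-* _ _ ⟩
    map x * map (x FP.⁻¹⟨ x≢0 ⟩)        ≡⟨ cong (_* map (x FP.⁻¹⟨ x≢0 ⟩)) mx≡0 ⟩
    0# * map (x FP.⁻¹⟨ x≢0 ⟩)           ≡⟨ zeroˡ _ ⟩
    0#                                 ∎)

  map≡0⇒≡0 : ∀ {x} → map x ≡ 0# → x ≡ F.0#
  map≡0⇒≡0 {x} mx≡0 with x ≟F F.0#
  ... | yes x≡0 = x≡0
  ... | no x≢0 = ⊥-elim (map-nonZero x≢0 mx≡0)

  map-injective : ∀ {x y} → map x ≡ map y → x ≡ y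
  map-injective {x} {y} mx≡my = FP.x-y≡0⇒x≡y (map≡0⇒≡0 (trans (map-sub x y) (x≡y⇒x-y≡0 mx≡my)))

  map-^ : ∀ x n → map (x FP.^ n) ≡ map x ^ n
  map-^ x zero = map-1
  map-^ x (suc n) = trans (map-* x (x FP.^ n)) (cong (map x *_) (map-^ x n))

  lift : Vec3 F → Vec3 K
  lift v = vec (λ i → map (coord v i))

  lift-cong : ∀ {u v} → u FS.≐ v → lift u ≐ lift v
  lift-cong u≐v = coordwise λ i → cong map (FS.at u≐v i)

  lift-nonZero : ∀ {P} → NonZero P → NonZero (lift P)
  lift-nonZero P≢0 P′≡0 = P≢0 (λ i → map≡0⇒≡0 (P′≡0 i))

  lift-· : ∀ A v → lift (A · v) ≐ liftMat ι A · lift v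
  lift-· A v = coordwise λ i → begin
    map (entry A i i0 F.* coord v i0 F.+ entry A i i1 F.* coord v i1 F.+ entry A i i2 F.* coord v i2)
      ≡⟨ trans (map-+ _ _) (cong (_+ _) (map-+ _ _)) ⟩
    map (entry A i i0 F.* coord v i0) + map (entry A i i1 F.* coord v i1) + map (entry A i i2 F.* coord v i2)
      ≡⟨ cong₃ (λ a b c → a + b + c) (map-* _ _) (map-* _ _) (map-* _ _) ⟩
    coord (liftMat ι A · lift v) i ∎

  lift-^ : ∀ A e v → lift ((A ^ᴹ e) · v) ≐ (liftMat ι A ^ᴹ e) · lift v
  lift-^ A zero v = ≐-trans (lift-cong (FS.I3-· v)) (≐-sym (I3-· (lift v)))
  lift-^ A (suc e) v = ≐-trans (lift-cong (FS.⊗-· A (A ^ᴹ e) v))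
    (≐-trans (lift-· A ((A ^ᴹ e) · v))
      (≐-trans (·-cong (liftMat ι A) (lift-^ A e v))
        (≐-sym (⊗-· (liftMat ι A) (liftMat ι A ^ᴹ e) (lift v)))))

  lift-scale : ∀ s v → lift (FS.scale s v) ≐ scale (map s) (lift v)
  lift-scale s v = coordwise λ i → map-* s (coord v i)

  map-det3 : ∀ u v w → map (det3 u v w) ≡ det3 (lift u) (lift v) (lift w)
  map-det3 u v w = begin
    map (A0 F.- A1 F.+ A2)      ≡⟨ map-+ _ _ ⟩
    map (A0 F.- A1) + map A2    ≡⟨ cong (_+ map A2) (map-sub _ _) ⟩
    map A0 - map A1 + map A2    ≡⟨ cong₃ (λ a b c → a - b + c) (term (coord u i0) _ _ _ _) (term (coord u i1) _ _ _ _) (term (coord u i2) _ _ _ _) ⟩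
    det3 (lift u) (lift v) (lift w) ∎
    where
    A0 = coord u i0 F.* (coord v i1 F.* coord w i2 F.- coord v i2 F.* coord w i1)
    A1 = coord u i1 F.* (coord v i0 F.* coord w i2 F.- coord v i2 F.* coord w i0)
    A2 = coord u i2 F.* (coord v i0 F.* coord w i1 F.- coord v i1 F.* coord w i0)
    term : ∀ x a b c d → map (x F.* (a F.* b F.- c F.* d)) ≡ map x * (map a * map b - map c * map d)
    term x a b c d = trans (map-* _ _) (cong (map x *_) (trans (map-sub _ _) (cong₂ _-_ (map-* a b) (map-* c d))))

  eval-lift : ∀ G P → eval (liftQ ι G) (lift P) ≡ map (eval G P)
  eval-lift (qform a b c d e f) P = sym (begin
    map (T1 F.+ T2 F.+ T3 F.+ T4 F.+ T5 F.+ T6)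
      ≡⟨ trans (map-+ _ _) (cong (_+ map T6) (trans (map-+ _ _) (cong (_+ map T5) (trans (map-+ _ _)
           (cong (_+ map T4) (trans (map-+ _ _) (cong (_+ map T3) (map-+ _ _)))))))) ⟩
    map T1 + map T2 + map T3 + map T4 + map T5 + map T6
      ≡⟨ cong₃ (λ p q r → p + q + r + map T4 + map T5 + map T6) (term a x x) (term b y y) (term c z z) ⟩
    _ ≡⟨ cong₃ (λ p q r → map a * map x * map x + map b * map y * map y + map c * map z * map z + p + q + r)
           (term d x y) (term e x z) (term f y z) ⟩
    eval (liftQ ι (qform a b c d e f)) (lift P) ∎)
    where
    x = coord P i0
    y = coord P i1
    z = coord P i2
    T1 = a F.* x F.* x
    T2 = b F.* y F.* y
    T3 = c F.* z F.* z
    T4 = d F.* x F.* y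
    T5 = e F.* x F.* z
    T6 = f F.* y F.* z
    term : ∀ a u v → map (a F.* u F.* v) ≡ map a * map u * map v
    term a u v = trans (map-* _ _) (cong (_* map v) (map-* a u))

  private
    proportional⇒∼-via : ∀ (P R : Vec3 F) t → NonZero P → lift P ≐ scale t (lift R) →
                          ∀ j → coord R j ≢ F.0# → P ∼ R
    proportional⇒∼-via P R t P≢0 P′≐tR′ j Rj≢0 = s , s≢0 , λ i → map-injective (begin
      map (coord P i)               ≡⟨ at P′≐tR′ i ⟩
      t * map (coord R i)           ≡⟨ cong (_* map (coord R i)) map-s ⟨
      map s * map (coord R i)       ≡⟨ map-* _ _ ⟨
      map (s F.* coord R i)         ∎)
      where
      s = coord P j F.* coord R j FP.⁻¹⟨ Rj≢0 ⟩

      map-s : map s ≡ t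
      map-s = *-cancelʳ (map-nonZero Rj≢0) (begin
        map s * map (coord R j)     ≡⟨ map-* _ _ ⟨
        map (s F.* coord R j)       ≡⟨ cong map (trans (FP.*-assoc _ _ _) (trans (cong (coord P j F.*_) (FP.inverseˡ _ Rj≢0)) (FP.*-identityʳ _))) ⟩
        map (coord P j)             ≡⟨ at P′≐tR′ j ⟩
        t * map (coord R j)         ∎)

      s≢0 : s ≢ F.0#
      s≢0 s≡0 = P≢0 (λ i → map≡0⇒≡0 (begin
        map (coord P i)             ≡⟨ at P′≐tR′ i ⟩
        t * map (coord R i)         ≡⟨ cong (_* map (coord R i)) (trans (sym map-s) (trans (cong map s≡0) map-0)) ⟩
        0# * map (coord R i)        ≡⟨ zeroˡ _ ⟩
        0#                          ∎))

  proportional⇒∼ : ∀ (P R : Vec3 F) t → NonZero P → NonZero R → lift P ≐ scale t (lift R) → P ∼ R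
  proportional⇒∼ P R t P≢0 R≢0 P′≐tR′ with coord R i0 ≟F F.0# | coord R i1 ≟F F.0# | coord R i2 ≟F F.0#
  ... | yes R0≡0 | yes R1≡0 | yes R2≡0 = ⊥-elim (R≢0 (FS.fin3-cases R0≡0 R1≡0 R2≡0))
  ... | no R0≢0 | _ | _ = proportional⇒∼-via P R t P≢0 P′≐tR′ i0 R0≢0
  ... | yes _ | no R1≢0 | _ = proportional⇒∼-via P R t P≢0 P′≐tR′ i1 R1≢0
  ... | yes _ | yes _ | no R2≢0 = proportional⇒∼-via P R t P≢0 P′≐tR′ i2 R2≢0

  ∼⇒lift≐ : ∀ {P R : Vec3 F} (P∼R : P ∼ R) → lift P ≐ scale (map (proj₁ P∼R)) (lift R)
  ∼⇒lift≐ (s , _ , P≡sR) = coordwise λ i → trans (cong map (P≡sR i)) (map-* _ _)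

  module _ {r} (enumeration : F.Carrier ↔ Fin (suc (suc r))) (_≟K_ : (x y : Carrier) → Dec (x ≡ y)) where
    private
      module Enum = FiniteField F enumeration
      open FieldAlgebra K using (evalPoly; zero-of-too-many-roots)
      open Solver

      x^q-x : List Carrier
      x^q-x = 0# ∷ - 1# ∷ replicate r 0# ++ 1# ∷ []

      evalPoly-monomial : ∀ n x → evalPoly (replicate n 0# ++ 1# ∷ []) x ≡ x ^ n
      evalPoly-monomial zero x = trans (cong (1# +_) (zeroʳ x)) (+-identityʳ 1#)
      evalPoly-monomial (suc n) x = trans (+-identityˡ _) (cong (x *_) (evalPoly-monomial n x))

      evalPoly-x^q-x : ∀ x → evalPoly x^q-x x ≡ x ^ suc (suc r) - x
      evalPoly-x^q-x x = begin
        0# + x * (- 1# + x * evalPoly (replicate r 0# ++ 1# ∷ []) x)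
          ≡⟨ cong (λ t → 0# + x * (- 1# + x * t)) (evalPoly-monomial r x) ⟩
        0# + x * (- 1# + x * x ^ r)
          ≡⟨ solve 2 (λ x y → con 0ℤ :+ x :* (:- con 1ℤ :+ x :* y) := x :* (x :* y) :- x) refl x (x ^ r) ⟩
        x ^ suc (suc r) - x ∎

      length-x^q-x : length x^q-x ≡ suc (suc (suc r))
      length-x^q-x = cong (λ n → suc (suc n)) (trans (List.length-++ (replicate r 0#))
        (trans (cong (ℕ._+ 1) (List.length-replicate r)) (ℕ.+-comm r 1)))

      images : List Carrier
      images = tabulate (λ j → map (Enum.element j))

      x^q-x≢0 : ¬ All (_≡ 0#) x^q-x
      x^q-x≢0 (_ ∷ _ ∷ rest) with All.++⁻ʳ (replicate r 0#) rest
      ... | 1≡0 ∷ _ = 1≢0 1≡0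

    fixed⇒image : ∀ x → x ^ suc (suc r) ≡ x → ∃ λ a → map a ≡ x
    fixed⇒image x x^q≡x with Fin.any? (λ j → map (Enum.element j) ≟K x)
    ... | yes (j , eq) = Enum.element j , eq
    ... | no x∉images = ⊥-elim (x^q-x≢0 (zero-of-too-many-roots (x ∷ images) x^q-x
          (ℕ.≤-reflexive (trans length-x^q-x (cong suc (sym (List.length-tabulate (λ j → map (Enum.element j)))))))
          (All.tabulate⁺ (λ j x≡ → x∉images (j , sym x≡)) ∷ Unique.tabulate⁺ (λ eq → Enum.element-injective (map-injective eq)))
          (root x x^q≡x ∷ All.tabulate⁺ {f = λ j → map (Enum.element j)}
            (λ j → root _ (trans (sym (map-^ (Enum.element j) (suc (suc r)))) (cong map (Enum.x^[1+m]≡x (Enum.element j))))))))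
      where
      root : ∀ y → y ^ suc (suc r) ≡ y → evalPoly x^q-x y ≡ 0#
      root y y^q≡y = trans (evalPoly-x^q-x y) (x≡y⇒x-y≡0 y^q≡y)

cube-factorisation : ∀ m → suc m ℕ.^ 3 ≡ suc (m ℕ.* (suc m ℕ.* suc m ℕ.+ suc m ℕ.+ 1))
cube-factorisation = solve 1 (λ m → (con 1 :+ m) :^ 3 := con 1 :+ m :* ((con 1 :+ m) :* (con 1 :+ m) :+ (con 1 :+ m) :+ con 1)) refl
  where open +-*-Solver

module Singer (q : ℕ) (q-primePower : IsPrimePower q) (F K : Field)
  (|F| : HasOrder F q) (|K| : HasOrder K (q ℕ.^ 3)) (ι : FieldEmbedding F K)
  (σ : Mat3 F) (singer : IsSingerGenerator (q ℕ.* q ℕ.+ q ℕ.+ 1) σ) where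

  private
    module F = Field F
    module FP = FieldProperties F
    module FS = Space F
  open Field K
  open FieldProperties K
  open Solver
  open Space K
  open FieldEmbedding ι
  open IsSingerGenerator singer
  open FieldAlgebra K using (evalPoly; nonRoot; frobenius-+; characteristic-of-power)
  open ≡-Reasoning

  N : ℕ
  N = q ℕ.* q ℕ.+ q ℕ.+ 1

  private
    p = proj₁ q-primePower
    k = proj₁ (proj₂ q-primePower)
    p-prime : Prime p
    p-prime = proj₁ (proj₂ (proj₂ q-primePower))
    q≡p^[1+k] : q ≡ p ℕ.^ suc k
    q≡p^[1+k] = proj₂ (proj₂ (proj₂ q-primePower))

    2≤q : 2 ≤ q
    2≤q = subst (2 ≤_) (sym q≡p^[1+k]) (ℕ.≤-trans 2≤p (ℕ.m≤m*n p (p ℕ.^ k)))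
      where
      2≤p = prime⇒2≤ p-prime
      instance
        _ = ℕ.>-nonZero (ℕ.≤-trans (s≤s z≤n) 2≤p)
        _ = ℕ.m^n≢0 p k

    r = q ∸ 2
    q≡2+r : q ≡ suc (suc r)
    q≡2+r = sym (ℕ.m+[n∸m]≡n 2≤q)

    -- |K×| = q³ − 1 = (q − 1) N
    |K×| = suc r ℕ.* N

    q³≡1+|K×| : q ℕ.^ 3 ≡ suc |K×|
    q³≡1+|K×| = trans (cong (ℕ._^ 3) q≡2+r) (trans (cube-factorisation (suc r)) (cong (λ t → suc (suc r ℕ.* (t ℕ.* t ℕ.+ t ℕ.+ 1))) (sym q≡2+r)))

    1<N : 1 < N
    1<N = ℕ.≤-trans 2≤q (ℕ.≤-trans (ℕ.m≤n+m q (q ℕ.* q)) (ℕ.m≤m+n (q ℕ.* q ℕ.+ q) 1))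

    module EnumF = FiniteField F (subst (λ n → F.Carrier ↔ Fin n) q≡2+r |F|)
    module EnumK = FiniteField K (subst (λ n → Carrier ↔ Fin n) q³≡1+|K×| |K|)

  _≟F_ = EnumF._≟_
  _≟K_ = EnumK._≟_

  open Embedding ι _≟F_ public

  private
    charK : p ×ᵣ 1# ≡ 0#
    charK = characteristic-of-power (_≟K 0#) p (suc k ℕ.* 3)
      (subst (λ n → n ×ᵣ 1# ≡ 0#) (trans (sym q³≡1+|K×|) (trans (cong (ℕ._^ 3) q≡p^[1+k]) (ℕ.^-*-assoc p (suc k) 3))) EnumK.characteristic)

  Φ : Carrier → Carrier
  Φ x = x ^ q

  Φ-+ : ∀ x y → Φ (x + y) ≡ Φ x + Φ y
  Φ-+ x y = subst (λ n → (x + y) ^ n ≡ x ^ n + y ^ n) (sym q≡p^[1+k]) (frobenius-+ p-prime charK (suc k) x y)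

  Φ-* : ∀ x y → Φ (x * y) ≡ Φ x * Φ y
  Φ-* x y = ^-distrib-* x y q

  Φ-map : ∀ a → Φ (map a) ≡ map a
  Φ-map a = trans (sym (map-^ a q)) (cong map (subst (λ n → a FP.^ n ≡ a) (sym q≡2+r) (EnumF.x^[1+m]≡x a)))

  Φ-0 : Φ 0# ≡ 0#
  Φ-0 = trans (cong (0# ^_) q≡2+r) (zeroˡ _)

  Φ-sub : ∀ x y → Φ (x - y) ≡ Φ x - Φ y
  Φ-sub x y = trans (Φ-+ x (- y)) (cong (Φ x +_) Φ-neg)
    where
    Φ-neg : Φ (- y) ≡ - Φ y
    Φ-neg = inverseʳ-unique (Φ y) (Φ (- y)) (trans (sym (Φ-+ y (- y))) (trans (cong Φ (-‿inverseʳ y)) Φ-0))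

  Φ³ : ∀ x → Φ (Φ (Φ x)) ≡ x
  Φ³ x = begin
    ((x ^ q) ^ q) ^ q              ≡⟨ cong (_^ q) (^-assocʳ x q q) ⟩
    (x ^ (q ℕ.* q)) ^ q            ≡⟨ ^-assocʳ x (q ℕ.* q) q ⟩
    x ^ (q ℕ.* q ℕ.* q)            ≡⟨ cong (x ^_) (trans (ℕ.*-assoc q q q) (cong (q ℕ.*_) (cong (q ℕ.*_) (sym (ℕ.*-identityʳ q))))) ⟩
    x ^ (q ℕ.^ 3)                  ≡⟨ cong (x ^_) q³≡1+|K×| ⟩
    x ^ suc |K×|                   ≡⟨ EnumK.x^[1+m]≡x x ⟩
    x                              ∎

  Φ-injective : ∀ {x y} → Φ x ≡ Φ y → x ≡ y
  Φ-injective {x} {y} Φx≡Φy = trans (sym (Φ³ x)) (trans (cong (λ t → Φ (Φ t)) Φx≡Φy) (Φ³ y))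

  Φ-nonZero : ∀ {x} → x ≢ 0# → Φ x ≢ 0#
  Φ-nonZero x≢0 = ^-nonZero q x≢0

  Φ-^ : ∀ x e → Φ (x ^ e) ≡ Φ x ^ e
  Φ-^ x e = trans (^-assocʳ x e q) (trans (cong (x ^_) (ℕ.*-comm e q)) (sym (^-assocʳ x q e)))

  Φ-fixed⇒image : ∀ x → Φ x ≡ x → ∃ λ a → map a ≡ x
  Φ-fixed⇒image x Φx≡x = fixed⇒image (subst (λ n → F.Carrier ↔ Fin n) q≡2+r |F|) _≟K_ x
    (subst (λ n → x ^ n ≡ x) q≡2+r Φx≡x)

  ΦV : Vec3 K → Vec3 K
  ΦV v = vec (λ i → Φ (coord v i))

  ΦV-nonZero : ∀ {u} → NonZero u → NonZero (ΦV u)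
  ΦV-nonZero u≢0 Φu≡0 = u≢0 (λ i → Φ-injective (trans (Φu≡0 i) (sym Φ-0)))

  ΦV-lift : ∀ P → ΦV (lift P) ≐ lift P
  ΦV-lift P = coordwise λ i → Φ-map _

  Φ-det3 : ∀ u v w → Φ (det3 u v w) ≡ det3 (ΦV u) (ΦV v) (ΦV w)
  Φ-det3 u v w = begin
    Φ (A0 - A1 + A2)          ≡⟨ Φ-+ _ _ ⟩
    Φ (A0 - A1) + Φ A2        ≡⟨ cong (_+ Φ A2) (Φ-sub _ _) ⟩
    Φ A0 - Φ A1 + Φ A2        ≡⟨ cong₃ (λ a b c → a - b + c) (term _ _ _ _ _) (term _ _ _ _ _) (term _ _ _ _ _) ⟩
    det3 (ΦV u) (ΦV v) (ΦV w) ∎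
    where
    A0 = x0 u * (x1 v * x2 w - x2 v * x1 w)
    A1 = x1 u * (x0 v * x2 w - x2 v * x0 w)
    A2 = x2 u * (x0 v * x1 w - x1 v * x0 w)
    term : ∀ a b c d e → Φ (a * (b * c - d * e)) ≡ Φ a * (Φ b * Φ c - Φ d * Φ e)
    term a b c d e = trans (Φ-* _ _) (cong (Φ a *_) (trans (Φ-sub _ _) (cong₂ _-_ (Φ-* b c) (Φ-* d e))))

  Φ-eval : ∀ G v → Φ (eval (liftQ ι G) v) ≡ eval (liftQ ι G) (ΦV v)
  Φ-eval (qform a b c d e f) v = begin
    Φ (T1 + T2 + T3 + T4 + T5 + T6)
      ≡⟨ trans (Φ-+ _ _) (cong (_+ Φ T6) (trans (Φ-+ _ _) (cong (_+ Φ T5) (trans (Φ-+ _ _)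
           (cong (_+ Φ T4) (trans (Φ-+ _ _) (cong (_+ Φ T3) (Φ-+ _ _)))))))) ⟩
    Φ T1 + Φ T2 + Φ T3 + Φ T4 + Φ T5 + Φ T6
      ≡⟨ cong₃ (λ r s t → r + s + t + Φ T4 + Φ T5 + Φ T6) (term a x x) (term b y y) (term c z z) ⟩
    _ ≡⟨ cong₃ (λ r s t → map a * Φ x * Φ x + map b * Φ y * Φ y + map c * Φ z * Φ z + r + s + t)
           (term d x y) (term e x z) (term f y z) ⟩
    eval (liftQ ι (qform a b c d e f)) (ΦV v) ∎
    where
    x = x0 v
    y = x1 v
    z = x2 v
    T1 = map a * x * x
    T2 = map b * y * y
    T3 = map c * z * z
    T4 = map d * x * y
    T5 = map e * x * z
    T6 = map f * y * z
    term : ∀ m u w → Φ (map m * u * w) ≡ map m * Φ u * Φ w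
    term m u w = trans (Φ-* _ _) (cong (_* Φ w) (trans (Φ-* _ _) (cong (_* Φ u) (Φ-map m))))

  M : Mat3 K
  M = liftMat ι σ

  private
    c₀ = proj₁ order
    c₀≢0 : c₀ ≢ F.0#
    c₀≢0 = proj₁ (proj₂ order)

    σ^[tN]-· : ∀ t v → (σ ^ᴹ (t ℕ.* N)) · v FS.≐ FS.scale (c₀ FP.^ t) v
    σ^[tN]-· zero v = FS.≐-trans (FS.I3-· v) (FS.coordwise λ i → sym (FP.*-identityˡ _))
    σ^[tN]-· (suc t) v = FS.≐-trans (FS.^ᴹ-+-· σ N (t ℕ.* N) v)
      (FS.≐-trans (FS.scalar-· (σ ^ᴹ N) c₀ (proj₂ (proj₂ order)) _)
        (FS.coordwise λ i → trans (cong (c₀ F.*_) (FS.at (σ^[tN]-· t v) i)) (sym (FP.*-assoc _ _ _))))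

    -- σ^(q³−1) = c₀^(q−1) I = I
    M^|K×|-lift : ∀ v → (M ^ᴹ |K×|) · lift v ≐ lift v
    M^|K×|-lift v = ≐-trans (≐-sym (lift-^ σ |K×| v)) (lift-cong (FS.≐-trans (σ^[tN]-· (suc r) v)
      (FS.coordwise λ i → trans (cong (F._* coord v i) (EnumF.x^m≡1 c₀ c₀≢0)) (FP.*-identityˡ _))))

  module _ (μ : Carrier) where

    geometricSum : ℕ → Vec3 K → Vec3 K
    geometricSum zero v = zeroVec
    geometricSum (suc n) v = v ⊕ scale μ (geometricSum n (M · v))

    geometricSum-· : ∀ n v → geometricSum n (M · v) ≐ M · geometricSum n v
    geometricSum-· zero v = ≐-sym (·-zeroVec M)
    geometricSum-· (suc n) v = ≐-trans
      (coordwise λ i → cong (λ t → coord (M · v) i + μ * t) (at (geometricSum-· n (M · v)) i))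
      (≐-trans (coordwise λ i → cong (coord (M · v) i +_) (sym (at (·-scale M μ (geometricSum n (M · v))) i)))
        (≐-sym (·-⊕ M v (scale μ (geometricSum n (M · v))))))

    telescope : ∀ n v → scale μ (geometricSum n (M · v)) ⊕ v ≐ geometricSum n v ⊕ scale (μ ^ n) ((M ^ᴹ n) · v)
    telescope zero v = coordwise λ i →
      trans (solve 2 (λ m x → m :* con 0ℤ :+ x := con 0ℤ :+ con 1ℤ :* x) refl μ (coord v i))
            (cong (λ t → 0# + 1# * t) (sym (at (I3-· v) i)))
    telescope (suc n) v = coordwise λ i → begin
      μ * (coord (M · v) i + μ * coord (geometricSum n (M · (M · v))) i) + coord v i
        ≡⟨ solve 4 (λ m a w x → m :* (a :+ m :* w) :+ x := m :* (m :* w :+ a) :+ x) refl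
             μ (coord (M · v) i) (coord (geometricSum n (M · (M · v))) i) (coord v i) ⟩
      μ * (μ * coord (geometricSum n (M · (M · v))) i + coord (M · v) i) + coord v i
        ≡⟨ cong (λ t → μ * t + coord v i) (at (telescope n (M · v)) i) ⟩
      μ * (coord (geometricSum n (M · v)) i + μ ^ n * coord ((M ^ᴹ n) · (M · v)) i) + coord v i
        ≡⟨ cong (λ t → μ * (coord (geometricSum n (M · v)) i + μ ^ n * t) + coord v i) (sym (at (^ᴹ-suc-· M n v) i)) ⟩
      μ * (coord (geometricSum n (M · v)) i + μ ^ n * coord ((M ^ᴹ suc n) · v) i) + coord v i
        ≡⟨ solve 5 (λ m w u c x → m :* (w :+ u :* c) :+ x := (x :+ m :* w) :+ (m :* u) :* c) refl
             μ (coord (geometricSum n (M · v)) i) (μ ^ n) (coord ((M ^ᴹ suc n) · v) i) (coord v i) ⟩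
      (coord v i + μ * coord (geometricSum n (M · v)) i) + μ ^ suc n * coord ((M ^ᴹ suc n) · v) i ∎

  firstCoordinates : ℕ → Vec3 K → List Carrier
  firstCoordinates zero v = []
  firstCoordinates (suc n) v = x0 v ∷ firstCoordinates n (M · v)

  private
    x0-geometricSum : ∀ μ n v → x0 (geometricSum μ n v) ≡ evalPoly (firstCoordinates n v) μ
    x0-geometricSum μ zero v = refl
    x0-geometricSum μ (suc n) v = cong (λ t → x0 v + μ * t) (x0-geometricSum μ n (M · v))

    length-firstCoordinates : ∀ n v → length (firstCoordinates n v) ≡ n
    length-firstCoordinates zero v = refl
    length-firstCoordinates (suc n) v = cong suc (length-firstCoordinates n (M · v))

    e₀ : Vec3 K
    e₀ = lift (FS.vec3 F.1# F.0# F.0#)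

    |K×|≡suc : |K×| ≡ suc (q ℕ.* q ℕ.+ q ℕ.+ r ℕ.* N)
    |K×|≡suc = cong (ℕ._+ r ℕ.* N) (ℕ.+-comm (q ℕ.* q ℕ.+ q) 1)

    firstCoordinates-e₀≢0 : ¬ All (_≡ 0#) (firstCoordinates |K×| e₀)
    firstCoordinates-e₀≢0 = subst (λ n → ¬ All (_≡ 0#) (firstCoordinates n e₀)) (sym |K×|≡suc)
      (λ { (e₀≡0 ∷ _) → 1≢0 (trans (sym map-1) e₀≡0) })

    nonzeroElement : Fin |K×| → Carrier
    nonzeroElement j = EnumK.element (punchIn (EnumK.index 0#) j)

    nonzeroElement-nonZero : ∀ j → nonzeroElement j ≢ 0#
    nonzeroElement-nonZero j eq = Fin.punchInᵢ≢i (EnumK.index 0#) j (trans (sym (EnumK.index-element _)) (cong EnumK.index eq))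

    nonzeroElement-injective : ∀ {i j} → nonzeroElement i ≡ nonzeroElement j → i ≡ j
    nonzeroElement-injective eq = Fin.punchIn-injective (EnumK.index 0#) _ _ (EnumK.element-injective eq)

    -- The first coordinate of geometricSum μ |K×| e₀ is a polynomial in μ of
    -- degree < |K×| with constant term 1, so it does not vanish on all of K×.
    μ-nonRoot = nonRoot _≟K_ nonzeroElement nonzeroElement-injective (firstCoordinates |K×| e₀)
      (ℕ.≤-reflexive (length-firstCoordinates |K×| e₀)) firstCoordinates-e₀≢0

    μ : Carrier
    μ = nonzeroElement (proj₁ μ-nonRoot)

    μ≢0 : μ ≢ 0#
    μ≢0 = nonzeroElement-nonZero (proj₁ μ-nonRoot)

  w₁ : Vec3 K
  w₁ = geometricSum μ |K×| e₀

  λ₁ : Carrier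
  λ₁ = μ ⁻¹⟨ μ≢0 ⟩

  w₁≢0 : NonZero w₁
  w₁≢0 w₁≡0 = proj₂ μ-nonRoot (trans (sym (x0-geometricSum μ |K×| e₀)) (w₁≡0 i0))

  λ₁≢0 : λ₁ ≢ 0#
  λ₁≢0 λ₁≡0 = 1≢0 (trans (sym (inverseʳ μ μ≢0)) (trans (cong (μ *_) λ₁≡0) (zeroʳ μ)))

  eigen₁ : ∀ i → coord (M · w₁) i ≡ λ₁ * coord w₁ i
  eigen₁ i = begin
    coord (M · w₁) i                   ≡⟨ *-identityˡ _ ⟨
    1# * coord (M · w₁) i              ≡⟨ cong (_* coord (M · w₁) i) (inverseˡ μ μ≢0) ⟨
    (λ₁ * μ) * coord (M · w₁) i        ≡⟨ *-assoc _ _ _ ⟩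
    λ₁ * (μ * coord (M · w₁) i)        ≡⟨ cong (λ₁ *_) μMw₁≡w₁ ⟩
    λ₁ * coord w₁ i                    ∎
    where
    μMw₁≡w₁ : μ * coord (M · w₁) i ≡ coord w₁ i
    μMw₁≡w₁ = +-cancelʳ (begin
      μ * coord (M · w₁) i + coord e₀ i
        ≡⟨ cong (λ t → μ * t + coord e₀ i) (sym (at (geometricSum-· μ |K×| e₀) i)) ⟩
      μ * coord (geometricSum μ |K×| (M · e₀)) i + coord e₀ i
        ≡⟨ at (telescope μ |K×| e₀) i ⟩
      coord w₁ i + μ ^ |K×| * coord ((M ^ᴹ |K×|) · e₀) i
        ≡⟨ cong₂ (λ a b → coord w₁ i + a * b) (EnumK.x^m≡1 μ μ≢0) (at (M^|K×|-lift (FS.vec3 F.1# F.0# F.0#)) i) ⟩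
      coord w₁ i + 1# * coord e₀ i
        ≡⟨ cong (coord w₁ i +_) (*-identityˡ _) ⟩
      coord w₁ i + coord e₀ i ∎)

  private
    ΦV-· : ∀ u → M · ΦV u ≐ ΦV (M · u)
    ΦV-· u = coordwise λ i → sym (begin
      Φ (map (entry σ i i0) * x0 u + map (entry σ i i1) * x1 u + map (entry σ i i2) * x2 u)
        ≡⟨ trans (Φ-+ _ _) (cong (_+ Φ (map (entry σ i i2) * x2 u)) (Φ-+ _ _)) ⟩
      Φ (map (entry σ i i0) * x0 u) + Φ (map (entry σ i i1) * x1 u) + Φ (map (entry σ i i2) * x2 u)
        ≡⟨ cong₃ (λ a b c → a + b + c) (term i i0) (term i i1) (term i i2) ⟩
      coord (M · ΦV u) i ∎)
      where
      term : ∀ i j → Φ (map (entry σ i j) * coord u j) ≡ map (entry σ i j) * Φ (coord u j)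
      term i j = trans (Φ-* _ _) (cong (_* Φ (coord u j)) (Φ-map _))

    ΦV-eigen : ∀ {u l} → (∀ i → coord (M · u) i ≡ l * coord u i) → ∀ i → coord (M · ΦV u) i ≡ Φ l * coord (ΦV u) i
    ΦV-eigen {u} {l} Mu≡lu i = trans (at (ΦV-· u) i) (trans (cong Φ (Mu≡lu i)) (Φ-* l (coord u i)))

  w₂ w₃ : Vec3 K
  w₂ = ΦV w₁
  w₃ = ΦV w₂

  λ₂ λ₃ : Carrier
  λ₂ = Φ λ₁
  λ₃ = Φ λ₂

  ΦV-w₃ : ΦV w₃ ≐ w₁
  ΦV-w₃ = coordwise λ i → Φ³ (coord w₁ i)

  -- An eigenvalue in F would give a point of π fixed by σ.
  λ₁∉F : ¬ (∃ λ a → map a ≡ λ₁)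
  λ₁∉F (a , map-a≡λ₁) = order-min 1 (s≤s z≤n) 1<N (free 1 u u≢0 (a , a≢0 , σ¹u≡au))
    where
    a≢0 : a ≢ F.0#
    a≢0 a≡0 = λ₁≢0 (trans (sym map-a≡λ₁) (trans (cong map a≡0) map-0))

    map-I3 : ∀ i j → map (entry (I3 {F}) i j) ≡ entry (I3 {K}) i j
    map-I3 = FS.fin3-cases {P = λ i → ∀ j → map (entry (I3 {F}) i j) ≡ entry (I3 {K}) i j}
      (FS.fin3-cases map-1 map-0 map-0) (FS.fin3-cases map-0 map-1 map-0) (FS.fin3-cases map-0 map-0 map-1)

    lifted-entries : ∀ i j → entry (liftMat ι (σ FS.-ᴵ a)) i j ≡ entry (M -ᴵ λ₁) i j
    lifted-entries i j = trans (map-sub _ _) (cong (λ t → map (entry σ i j) - t)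
      (trans (map-* _ _) (cong₂ _*_ map-a≡λ₁ (map-I3 i j))))

    w₁∈kernel : Zero (liftMat ι (σ FS.-ᴵ a) · w₁)
    w₁∈kernel i = trans (at (·-cong-entries lifted-entries w₁) i)
      (trans (-ᴵ-· M λ₁ w₁ i) (x≡y⇒x-y≡0 (eigen₁ i)))

    singular : FS.detM (σ FS.-ᴵ a) ≡ F.0#
    singular = map≡0⇒≡0 (trans (map-det3 (FS.row (σ FS.-ᴵ a) i0) (FS.row (σ FS.-ᴵ a) i1) (FS.row (σ FS.-ᴵ a) i2))
      (Kernel.kernel⇒detM≡0 _≟K_ (liftMat ι (σ FS.-ᴵ a)) w₁ w₁≢0 w₁∈kernel))

    kernelVector = FS.Kernel.detM≡0⇒kernel _≟F_ (σ FS.-ᴵ a) singular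
    u = proj₁ kernelVector
    u≢0 = proj₁ (proj₂ kernelVector)

    σ¹u≡au : ∀ i → coord ((σ ^ᴹ 1) · u) i ≡ a F.* coord u i
    σ¹u≡au i = trans (FS.at (FS.≐-trans (FS.^ᴹ-suc-· σ 0 u) (FS.I3-· (σ · u))) i)
      (FP.x-y≡0⇒x≡y (trans (sym (FS.-ᴵ-· σ a u i)) (proj₂ (proj₂ kernelVector) i)))

  private
    λ₁≢λ₂ : λ₁ ≢ λ₂
    λ₁≢λ₂ λ₁≡λ₂ = λ₁∉F (Φ-fixed⇒image λ₁ (sym λ₁≡λ₂))
    λ₂≢λ₃ : λ₂ ≢ λ₃
    λ₂≢λ₃ λ₂≡λ₃ = λ₁≢λ₂ (Φ-injective λ₂≡λ₃)
    λ₃≢λ₁ : λ₃ ≢ λ₁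
    λ₃≢λ₁ λ₃≡λ₁ = λ₁≢λ₂ (trans (sym (Φ³ λ₁)) (cong Φ λ₃≡λ₁))

  open Eigenbasis K _≟K_ M w₁ w₂ w₃ λ₁ λ₂ λ₃
    w₁≢0 (ΦV-nonZero w₁≢0) (ΦV-nonZero (ΦV-nonZero w₁≢0))
    eigen₁ (ΦV-eigen eigen₁) (ΦV-eigen (ΦV-eigen eigen₁))
    λ₁≢0 (Φ-nonZero λ₁≢0) (Φ-nonZero (Φ-nonZero λ₁≢0)) λ₁≢λ₂ λ₂≢λ₃ λ₃≢λ₁ public

  -- The Frobenius map permutes the coordinates of a point of π cyclically.
  coordinate₁-lift : ∀ P → x1 (coordinates (lift P)) ≡ Φ (x0 (coordinates (lift P)))
  coordinate₁-lift P = sym (begin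
    Φ (det3 (lift P) w₂ w₃)               ≡⟨ Φ-det3 (lift P) w₂ w₃ ⟩
    det3 (ΦV (lift P)) w₃ (ΦV w₃)         ≡⟨ det3-cong (ΦV-lift P) (≐-refl {w₃}) ΦV-w₃ ⟩
    det3 (lift P) w₃ w₁                   ≡⟨ det3-rotate (lift P) w₃ w₁ ⟩
    det3 w₁ (lift P) w₃                   ∎)

  coordinate₂-lift : ∀ P → x2 (coordinates (lift P)) ≡ Φ (x1 (coordinates (lift P)))
  coordinate₂-lift P = sym (begin
    Φ (det3 w₁ (lift P) w₃)               ≡⟨ Φ-det3 w₁ (lift P) w₃ ⟩
    det3 w₂ (ΦV (lift P)) (ΦV w₃)         ≡⟨ det3-cong (≐-refl {w₂}) (ΦV-lift P) ΦV-w₃ ⟩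
    det3 w₂ (lift P) w₁                   ≡⟨ det3-rotate w₂ (lift P) w₁ ⟩
    det3 w₁ w₂ (lift P)                   ∎)

  -- so a point of π lies on no side of the triangle Δ.
  coordinates-lift-nonZero : ∀ {P} → NonZero P →
    x0 (coordinates (lift P)) ≢ 0# × x1 (coordinates (lift P)) ≢ 0# × x2 (coordinates (lift P)) ≢ 0#
  coordinates-lift-nonZero {P} P≢0 = c₀≢0′ , c₁≢0 , c₂≢0
    where
    c₀≢0′ : x0 (coordinates (lift P)) ≢ 0#
    c₀≢0′ c₀≡0 = lift-nonZero P≢0 (coordinates-zero (lift P) (fin3-cases c₀≡0 c₁≡0 c₂≡0))
      where
      c₁≡0 = trans (coordinate₁-lift P) (trans (cong Φ c₀≡0) Φ-0)
      c₂≡0 = trans (coordinate₂-lift P) (trans (cong Φ c₁≡0) Φ-0)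
    c₁≢0 : x1 (coordinates (lift P)) ≢ 0#
    c₁≢0 c₁≡0 = c₀≢0′ (Φ-injective (trans (sym (coordinate₁-lift P)) (trans c₁≡0 (sym Φ-0))))
    c₂≢0 : x2 (coordinates (lift P)) ≢ 0#
    c₂≢0 c₂≡0 = c₁≢0 (Φ-injective (trans (sym (coordinate₂-lift P)) (trans c₂≡0 (sym Φ-0))))

  coordinates-σ^ : ∀ e P → coordinates (lift ((σ ^ᴹ e) · P)) ≐ diag (λ₁ ^ e) (λ₂ ^ e) (λ₃ ^ e) (coordinates (lift P))
  coordinates-σ^ e P = ≐-trans (coordinates-cong (lift-^ σ e P)) (coordinates-^ e (lift P))

  module Power (e : ℕ) (0<e : 0 < e) (e<N : e < N) where

    L₁ L₂ L₃ : Carrier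
    L₁ = λ₁ ^ e
    L₂ = λ₂ ^ e
    L₃ = λ₃ ^ e

    private
      L₂≡ΦL₁ : L₂ ≡ Φ L₁
      L₂≡ΦL₁ = sym (Φ-^ λ₁ e)
      L₃≡ΦL₂ : L₃ ≡ Φ L₂
      L₃≡ΦL₂ = sym (Φ-^ λ₂ e)

      not-scalar : ∀ c → map c ≡ L₁ → map c ≡ L₂ → map c ≡ L₃ → ⊥
      not-scalar c c≡L₁ c≡L₂ c≡L₃ = order-min e 0<e e<N (c , c≢0 , FS.scalar-action⇒scalar (σ ^ᴹ e) c acts-as-c)
        where
        c≢0 : c ≢ F.0#
        c≢0 c≡0 = ^-nonZero e λ₁≢0 (trans (sym c≡L₁) (trans (cong map c≡0) map-0))

        acts-as-c : ∀ P → (σ ^ᴹ e) · P FS.≐ FS.scale c P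
        acts-as-c P = FS.coordwise λ i → map-injective (at (coordinates-injective {lift ((σ ^ᴹ e) · P)} {lift (FS.scale c P)} (same-coordinates)) i)
          where
          same-coordinates : coordinates (lift ((σ ^ᴹ e) · P)) ≐ coordinates (lift (FS.scale c P))
          same-coordinates = ≐-trans (coordinates-σ^ e P)
            (≐-trans (coordwise (fin3-cases (cong (_* x0 (coordinates (lift P))) (sym c≡L₁))
                                           (cong (_* x1 (coordinates (lift P))) (sym c≡L₂))
                                           (cong (_* x2 (coordinates (lift P))) (sym c≡L₃))))
              (≐-sym (≐-trans (coordinates-cong (lift-scale c P)) (coordinates-scale (map c) (lift P)))))

      L₁∉F : Φ L₁ ≡ L₁ → ⊥
      L₁∉F ΦL₁≡L₁ = not-scalar c c≡L₁ (trans c≡L₁ (trans (sym ΦL₁≡L₁) (sym L₂≡ΦL₁)))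
        (trans c≡L₁ (trans (sym ΦL₁≡L₁) (trans (sym (cong Φ ΦL₁≡L₁)) (trans (cong Φ (sym L₂≡ΦL₁)) (sym L₃≡ΦL₂)))))
        where
        c = proj₁ (Φ-fixed⇒image L₁ ΦL₁≡L₁)
        c≡L₁ : map c ≡ L₁
        c≡L₁ = proj₂ (Φ-fixed⇒image L₁ ΦL₁≡L₁)

    L₁≢0 : L₁ ≢ 0#
    L₁≢0 = ^-nonZero e λ₁≢0
    L₂≢0 : L₂ ≢ 0#
    L₂≢0 = ^-nonZero e (Φ-nonZero λ₁≢0)
    L₃≢0 : L₃ ≢ 0#
    L₃≢0 = ^-nonZero e (Φ-nonZero (Φ-nonZero λ₁≢0))

    L₁≢L₂ : L₁ ≢ L₂
    L₁≢L₂ L₁≡L₂ = L₁∉F (trans (sym L₂≡ΦL₁) (sym L₁≡L₂))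
    L₂≢L₃ : L₂ ≢ L₃
    L₂≢L₃ L₂≡L₃ = L₁∉F (sym (Φ-injective (trans (sym L₂≡ΦL₁) (trans L₂≡L₃ (trans L₃≡ΦL₂ (cong Φ L₂≡ΦL₁))))))
    L₃≢L₁ : L₃ ≢ L₁
    L₃≢L₁ L₃≡L₁ = L₁∉F (sym (trans (sym (Φ³ L₁)) (cong Φ (trans (cong Φ (sym L₂≡ΦL₁)) (trans (sym L₃≡ΦL₂) L₃≡L₁)))))

  det3-coordinates-lift : ∀ X Y Z →
    det3 (coordinates (lift X)) (coordinates (lift Y)) (coordinates (lift Z)) ≡ D * D * map (det3 X Y Z)
  det3-coordinates-lift X Y Z = trans (det3-coordinates (lift X) (lift Y) (lift Z)) (cong (D * D *_) (sym (map-det3 X Y Z)))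

  coordinates-proportional⇒∼ : ∀ {X R} s → NonZero X → NonZero R →
    coordinates (lift X) ≐ scale s (coordinates (lift R)) → X ∼ R
  coordinates-proportional⇒∼ {X} {R} s X≢0 R≢0 X′≐sR′ = proportional⇒∼ X R s X≢0 R≢0
    (coordinates-injective {lift X} {scale s (lift R)} (≐-trans X′≐sR′ (≐-sym (coordinates-scale s (lift R)))))

  module BundleConic (Q : QForm F) (Q∈𝓑 : InCircumscribedBundle ι σ Q) where

    private
      G = liftQ ι Q

      G-vertex : ∀ {w l} → NonZero w → l ≢ 0# → (∀ i → coord (M · w) i ≡ l * coord w i) → eval G w ≡ 0#
      G-vertex w≢0 l≢0 Mw≡lw = proj₂ Q∈𝓑 _ w≢0 (_ , l≢0 , Mw≡lw)

      polar-sym : ∀ u v → polar G u v ≡ polar G v u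
      polar-sym u v = trans (cong (λ x → x - eval G u - eval G v) (eval-cong G {u ⊕ v} {v ⊕ u} (coordwise λ i → +-comm _ _)))
        (solve 3 (λ a b c → a :- b :- c := a :- c :- b) refl (eval G (v ⊕ u)) (eval G u) (eval G v))

      Φ-polar : ∀ u v → Φ (polar G u v) ≡ polar G (ΦV u) (ΦV v)
      Φ-polar u v = begin
        Φ (eval G (u ⊕ v) - eval G u - eval G v)                    ≡⟨ trans (Φ-sub _ _) (cong (_- Φ (eval G v)) (Φ-sub _ _)) ⟩
        Φ (eval G (u ⊕ v)) - Φ (eval G u) - Φ (eval G v)            ≡⟨ cong₃ (λ x y z → x - y - z) (Φ-eval Q (u ⊕ v)) (Φ-eval Q u) (Φ-eval Q v) ⟩
        eval G (ΦV (u ⊕ v)) - eval G (ΦV u) - eval G (ΦV v)         ≡⟨ cong (λ x → x - eval G (ΦV u) - eval G (ΦV v)) (eval-cong G {ΦV (u ⊕ v)} {ΦV u ⊕ ΦV v} (coordwise λ i → Φ-+ (coord u i) (coord v i))) ⟩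
        polar G (ΦV u) (ΦV v)                                       ∎

    a b c : Carrier
    a = polar G w₂ w₃
    b = polar G w₁ w₃
    c = polar G w₁ w₂

    eval-lift-coordinates : ∀ P → D * D * map (eval Q P) ≡ triangleForm a b c (coordinates (lift P))
    eval-lift-coordinates P = trans (cong (D * D *_) (sym (eval-lift Q P)))
      (eval-coordinates G (G-vertex w₁≢0 λ₁≢0 eigen₁) (G-vertex (ΦV-nonZero w₁≢0) (Φ-nonZero λ₁≢0) (ΦV-eigen eigen₁))
        (G-vertex (ΦV-nonZero (ΦV-nonZero w₁≢0)) (Φ-nonZero (Φ-nonZero λ₁≢0)) (ΦV-eigen (ΦV-eigen eigen₁))) (lift P))

    OnConic⇒triangleForm : ∀ P → OnConic Q P → triangleForm a b c (coordinates (lift P)) ≡ 0#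
    OnConic⇒triangleForm P P∈Q = trans (sym (eval-lift-coordinates P))
      (trans (cong (D * D *_) (trans (cong map P∈Q) map-0)) (zeroʳ _))

    private
      Φa≡b : Φ a ≡ b
      Φa≡b = trans (Φ-polar w₂ w₃) (trans (cong (polar G w₃) (≐⇒normal≡ ΦV-w₃)) (polar-sym w₃ w₁))

      Φb≡c : Φ b ≡ c
      Φb≡c = trans (Φ-polar w₁ w₃) (trans (cong (polar G w₂) (≐⇒normal≡ ΦV-w₃)) (polar-sym w₂ w₁))

    -- If a vanished, so would b = Φ a and c = Φ b, and Q would vanish everywhere.
    a≢0 : a ≢ 0#
    a≢0 a≡0 = proj₁ Q∈𝓑 (FS.vanishing⇒disc≡0 Q λ P → map≡0⇒≡0 (x*y≡0⇒y≡0 (*-nonZero D≢0 D≢0) (begin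
      D * D * map (eval Q P)                     ≡⟨ eval-lift-coordinates P ⟩
      triangleForm a b c (coordinates (lift P))  ≡⟨ cong₃ (λ a b c → triangleForm a b c (coordinates (lift P))) a≡0 b≡0 c≡0 ⟩
      triangleForm 0# 0# 0# (coordinates (lift P))
        ≡⟨ solve 3 (λ x y z → con 0ℤ :* (y :* z) :+ con 0ℤ :* (x :* z) :+ con 0ℤ :* (x :* y) := con 0ℤ) refl _ _ _ ⟩
      0#                                         ∎)))
      where
      b≡0 = trans (sym Φa≡b) (trans (cong Φ a≡0) Φ-0)
      c≡0 = trans (sym Φb≡c) (trans (cong Φ b≡0) Φ-0)

    b≢0 : b ≢ 0#
    b≢0 b≡0 = Φ-nonZero a≢0 (trans Φa≡b b≡0)

    c≢0 : c ≢ 0#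
    c≢0 c≡0 = Φ-nonZero b≢0 (trans Φb≡c c≡0)

  module Theorem (Q Q′ : QForm F) (Q∈𝓑 : InCircumscribedBundle ι σ Q) (Q≢Q′ : ¬ SameConic Q Q′)
    (k : ℕ) (k<N : k < N) (Q′≡Qᵍ : IsImageConic Q′ (σ ^ᴹ k) Q)
    (B : Vec3 F) (B≢0 : NonZero B) (B∈Q : OnConic Q B) (B∈Q′ : OnConic Q′ B)
    (A : Vec3 F) (A≢0 : NonZero A) (A∈Q : OnConic Q A) (Aᵍ∼B : ((σ ^ᴹ k) · A) ∼ B) where

    open BundleConic Q Q∈𝓑

    private
      g = σ ^ᴹ k
      h = σ ^ᴹ (N ∸ k)

      _′ : Vec3 F → Vec3 K
      X ′ = coordinates (lift X)

      0<k : 0 < k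
      0<k = ℕ.n≢0⇒n>0 k≢0
        where
        k≢0 : k ≢ 0
        k≢0 k≡0 = Q≢Q′ λ P P≢0 →
            (λ P∈Q → trans (sym (FS.eval-cong Q′ (g≐I P))) (proj₁ (Q′≡Qᵍ P P≢0) P∈Q))
          , (λ P∈Q′ → proj₂ (Q′≡Qᵍ P P≢0) (trans (FS.eval-cong Q′ (g≐I P)) P∈Q′))
          where
          g≐I : ∀ P → g · P FS.≐ P
          g≐I P = subst (λ n → (σ ^ᴹ n) · P FS.≐ P) (sym k≡0) (FS.I3-· P)

      moves : ∀ e → 0 < e → e < N → ¬ (((σ ^ᴹ e) · B) ∼ B)
      moves e 0<e e<N fixed = order-min e 0<e e<N (free e B B≢0 fixed)

      B′≢0 = coordinates-lift-nonZero B≢0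
      A′≢0 = coordinates-lift-nonZero A≢0

    module _ where
      open Power k 0<k k<N
      open TriangleConic K _≟K_ a b c L₁ L₂ L₃ a≢0 b≢0 c≢0 L₁≢0 L₂≢0 L₃≢0 L₁≢L₂ L₂≢L₃ L₃≢L₁

      private
        t = map (proj₁ Aᵍ∼B)

        t≢0 : t ≢ 0#
        t≢0 = map-nonZero (proj₁ (proj₂ Aᵍ∼B))

        Λ-lift : ∀ P → Λ (P ′) ≐ (g · P) ′
        Λ-lift P = ≐-sym (coordinates-σ^ k P)

        ΛA′≐tB′ : Λ (A ′) ≐ scale t (B ′)
        ΛA′≐tB′ = ≐-trans (Λ-lift A) (≐-trans (coordinates-cong (∼⇒lift≐ Aᵍ∼B)) (coordinates-scale t (lift B)))

        ΛA′∈conic : conic (Λ (A ′)) ≡ 0#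
        ΛA′∈conic = trans (cong conic (≐⇒normal≡ (Λ-lift A))) (OnConic⇒triangleForm (g · A) (FS.OnConic-∼ Aᵍ∼B B∈Q))

        secantᴬ = secant-through-ΛP0 (A ′) (proj₁ A′≢0) (proj₁ (proj₂ A′≢0)) (proj₂ (proj₂ A′≢0))
          (OnConic⇒triangleForm A A∈Q) ΛA′∈conic
        tangentᴬ = tangent-at-ΛP0 (A ′) (proj₁ A′≢0) (proj₁ (proj₂ A′≢0)) (proj₂ (proj₂ A′≢0))
          (OnConic⇒triangleForm A A∈Q) ΛA′∈conic

      secant-property : ∀ P → NonZero P → OnConic Q P → ¬ (P ∼ A) → ¬ (P ∼ B) → OnLineThrough B P (g · P)
      secant-property P P≢0 P∈Q _ _ = map≡0⇒≡0 (x*y≡0⇒y≡0 (*-nonZero D≢0 D≢0) (x*y≡0⇒y≡0 t≢0 (begin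
        t * (D * D * map (det3 B P (g · P)))          ≡⟨ cong (t *_) (det3-coordinates-lift B P (g · P)) ⟨
        t * det3 (B ′) (P ′) ((g · P) ′)              ≡⟨ det3-scale₁ t (B ′) (P ′) ((g · P) ′) ⟨
        det3 (scale t (B ′)) (P ′) ((g · P) ′)        ≡⟨ det3-cong ΛA′≐tB′ (≐-refl {P ′}) (Λ-lift P) ⟨
        det3 (Λ (A ′)) (P ′) (Λ (P ′))                ≡⟨ secantᴬ (P ′) (OnConic⇒triangleForm P P∈Q) ⟩
        0#                                            ∎)))

      tangent-to-Q : TangentAt Q B (g · B)
      tangent-to-Q = B∈Q , moves k 0<k k<N , tangency
        where
        tangency : ∀ X → NonZero X → OnLineThrough X B (g · B) → OnConic Q X → X ∼ B
        tangency X X≢0 X∈line X∈Q = coordinates-proportional⇒∼ (s * t) X≢0 B≢0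
            (≐-trans X′≐sΛA′ (≐-trans (scale-cong s ΛA′≐tB′) (scale-scale s t (B ′))))
          where
          Λ²A′≐tgB′ : Λ (Λ (A ′)) ≐ scale t ((g · B) ′)
          Λ²A′≐tgB′ = ≐-trans (diag-cong L₁ L₂ L₃ ΛA′≐tB′) (≐-trans (diag-scale L₁ L₂ L₃ t (B ′)) (scale-cong t (Λ-lift B)))

          on-line : det3 (X ′) (Λ (A ′)) (Λ (Λ (A ′))) ≡ 0#
          on-line = begin
            det3 (X ′) (Λ (A ′)) (Λ (Λ (A ′)))                 ≡⟨ det3-cong (≐-refl {X ′}) ΛA′≐tB′ Λ²A′≐tgB′ ⟩
            det3 (X ′) (scale t (B ′)) (scale t ((g · B) ′))   ≡⟨ det3-scale₂ t (X ′) (B ′) (scale t ((g · B) ′)) ⟩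
            t * det3 (X ′) (B ′) (scale t ((g · B) ′))         ≡⟨ cong (t *_) (det3-scale₃ t (X ′) (B ′) ((g · B) ′)) ⟩
            t * (t * det3 (X ′) (B ′) ((g · B) ′))             ≡⟨ cong (λ z → t * (t * z)) (det3-coordinates-lift X B (g · B)) ⟩
            t * (t * (D * D * map (det3 X B (g · B))))         ≡⟨ cong (λ z → t * (t * (D * D * z))) (trans (cong map X∈line) map-0) ⟩
            t * (t * (D * D * 0#))                             ≡⟨ solve 2 (λ t d → t :* (t :* (d :* d :* con 0ℤ)) := con 0ℤ) refl t D ⟩
            0#                                                 ∎

          s = proj₁ (tangentᴬ (X ′) (OnConic⇒triangleForm X X∈Q) on-line)
          X′≐sΛA′ = proj₂ (tangentᴬ (X ′) (OnConic⇒triangleForm X X∈Q) on-line)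

    module _ where
      private
        0<N∸k : 0 < N ∸ k
        0<N∸k = ℕ.m<n⇒0<n∸m k<N
        N∸k<N : N ∸ k < N
        N∸k<N = ℕ.∸-monoʳ-< 0<k (ℕ.<⇒≤ k<N)

      open Power (N ∸ k) 0<N∸k N∸k<N
      open TriangleConic K _≟K_ a b c L₁ L₂ L₃ a≢0 b≢0 c≢0 L₁≢0 L₂≢0 L₃≢0 L₁≢L₂ L₂≢L₃ L₃≢L₁

      private
        -- g h = σ^N is the scalar c₀, so h maps Q′ back onto Q.
        gh : ∀ P → g · (h · P) FS.≐ FS.scale c₀ P
        gh P = FS.≐-trans (FS.≐-sym (FS.^ᴹ-+-· σ k (N ∸ k) P))
          (subst (λ n → (σ ^ᴹ n) · P FS.≐ FS.scale c₀ P) (sym (ℕ.m+[n∸m]≡n (ℕ.<⇒≤ k<N)))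
            (FS.scalar-· (σ ^ᴹ N) c₀ (proj₂ (proj₂ order)) P))

        h-nonZero : ∀ {P} → NonZero P → NonZero (h · P)
        h-nonZero {P} P≢0 hP≡0 = P≢0 λ i → FP.x*y≡0⇒y≡0 c₀≢0 (trans (sym (FS.at (gh P) i))
          (FS.at (FS.≐-trans (FS.·-cong g (FS.coordwise hP≡0)) (FS.·-zeroVec g)) i))

        Q′⇒Qʰ : ∀ P → NonZero P → OnConic Q′ P → OnConic Q (h · P)
        Q′⇒Qʰ P P≢0 P∈Q′ = proj₂ (Q′≡Qᵍ (h · P) (h-nonZero P≢0))
          (trans (FS.eval-cong Q′ (gh P)) (trans (FS.eval-scale Q′ c₀ P) (trans (cong (c₀ F.* c₀ F.*_) P∈Q′) (FP.zeroʳ _))))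

        Λ-lift : ∀ P → Λ (P ′) ≐ (h · P) ′
        Λ-lift P = ≐-sym (coordinates-σ^ (N ∸ k) P)

        tangentᴮ = tangent-at-ΛP0 (B ′) (proj₁ B′≢0) (proj₁ (proj₂ B′≢0)) (proj₂ (proj₂ B′≢0))
          (OnConic⇒triangleForm B B∈Q)
          (trans (cong conic (≐⇒normal≡ (Λ-lift B))) (OnConic⇒triangleForm (h · B) (Q′⇒Qʰ B B≢0 B∈Q′)))

      tangent-to-Q′ : TangentAt Q′ B (h · B)
      tangent-to-Q′ = B∈Q′ , moves (N ∸ k) 0<N∸k N∸k<N , tangency
        where
        tangency : ∀ X → NonZero X → OnLineThrough X B (h · B) → OnConic Q′ X → X ∼ B
        tangency X X≢0 X∈line X∈Q′ = coordinates-proportional⇒∼ s X≢0 B≢0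
            (diag-cancel L₁≢0 L₂≢0 L₃≢0 (≐-trans (Λ-lift X) hX′≐sΛB′))
          where
          on-line : det3 ((h · X) ′) (Λ (B ′)) (Λ (Λ (B ′))) ≡ 0#
          on-line = begin
            det3 ((h · X) ′) (Λ (B ′)) (Λ (Λ (B ′)))             ≡⟨ det3-cong (≐-sym (Λ-lift X)) (≐-refl {Λ (B ′)}) (diag-cong L₁ L₂ L₃ (Λ-lift B)) ⟩
            det3 (Λ (X ′)) (Λ (B ′)) (Λ ((h · B) ′))              ≡⟨ det3-diag L₁ L₂ L₃ (X ′) (B ′) ((h · B) ′) ⟩
            L₁ * L₂ * L₃ * det3 (X ′) (B ′) ((h · B) ′)           ≡⟨ cong (L₁ * L₂ * L₃ *_) (det3-coordinates-lift X B (h · B)) ⟩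
            L₁ * L₂ * L₃ * (D * D * map (det3 X B (h · B)))       ≡⟨ cong (λ z → L₁ * L₂ * L₃ * (D * D * z)) (trans (cong map X∈line) map-0) ⟩
            L₁ * L₂ * L₃ * (D * D * 0#)                           ≡⟨ solve 2 (λ l d → l :* (d :* d :* con 0ℤ) := con 0ℤ) refl (L₁ * L₂ * L₃) D ⟩
            0#                                                    ∎

          s = proj₁ (tangentᴮ ((h · X) ′) (OnConic⇒triangleForm (h · X) (Q′⇒Qʰ X X≢0 X∈Q′)) on-line)
          hX′≐sΛB′ = proj₂ (tangentᴮ ((h · X) ′) (OnConic⇒triangleForm (h · X) (Q′⇒Qʰ X X≢0 X∈Q′)) on-line)

open import Data.Nat using (ℕ; _+_; _*_; _^_; _<_; _∸_)
open import Relation.Nullary using (¬_)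

mainTheorem4 :
  (q : ℕ) → IsPrimePower q →
  (F K : Field) → HasOrder F q → HasOrder K (q ^ 3) →
  (ι : FieldEmbedding F K) →
  (σ : Mat3 F) → IsSingerGenerator (q * q + q + 1) σ →
  (Q Q' : QForm F) →
  InCircumscribedBundle ι σ Q → InCircumscribedBundle ι σ Q' →
  ¬ SameConic Q Q' →
  (k : ℕ) → k < q * q + q + 1 → IsImageConic Q' (σ ^ᴹ k) Q →
  (B : Vec3 F) → NonZero B → OnConic Q B → OnConic Q' B →
  (∀ X → NonZero X → OnConic Q X → OnConic Q' X → X ∼ B) →
  (A : Vec3 F) → NonZero A → OnConic Q A → ((σ ^ᴹ k) · A) ∼ B →
  (∀ P → NonZero P → OnConic Q P → ¬ (P ∼ A) → ¬ (P ∼ B) →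
     OnLineThrough B P ((σ ^ᴹ k) · P))
  × TangentAt Q B ((σ ^ᴹ k) · B)
  × TangentAt Q' B ((σ ^ᴹ ((q * q + q + 1) ∸ k)) · B)
mainTheorem4 q q-primePower F K |F| |K| ι σ singer Q Q′ Q∈𝓑 _ Q≢Q′ k k<N Q′≡Qᵍ B B≢0 B∈Q B∈Q′ _ A A≢0 A∈Q Aᵍ∼B =
  secant-property , tangent-to-Q , tangent-to-Q′
  where
  open Singer q q-primePower F K |F| |K| ι σ singer
  open Theorem Q Q′ Q∈𝓑 Q≢Q′ k k<N Q′≡Qᵍ B B≢0 B∈Q B∈Q′ A A≢0 A∈Q Aᵍ∼B
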